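{- Let $\ell\ge r\ge 3$ be integers and $\binom{\ell}{2}-1\leq k<\frac{\ell^2-1}{2}$. For every $C>0$ there exist $C'>0$ and $n_0$ such that the following holds for all $n\ge n_0$. Suppose $\mathcal{H}_1,\dots,\mathcal{H}_k$ are $r$-graphs on a common $n$-vertex set $V$ containing no rainbow copy of $K_\ell^{(r)+}$, with $e(\mathcal{H}_1)\geq \dots\geq e(\mathcal{H}_k)$. If $\sum_{i\in[k]}e(\mathcal{H}_i)\geq \left(\binom{\ell}{2}-1\right)\binom{n}{r}-Cn^{r-1}$, then one can delete a set of at most $C'n^{r-1}$ hyperedges from $\bigcup_{i}\mathcal{H}_i$ such that every remaining hyperedge is contained in exactly the hypergraphs $\mathcal{H}_1,\dots,\mathcal{H}_{\binom{\ell}{2}-1}$ (and in no other $\mathcal{H}_i$).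
   Context: An $r$-graph is an $r$-uniform hypergraph. $K_\ell^{(r)+}$ is the $r$-expansion of the complete graph $K_\ell$: each edge of $K_\ell$ is enlarged by $r-2$ new vertices, all new vertices distinct from each other and from the $\ell$ original vertices. $r$-graphs $\mathcal{H}_1,\dots,\mathcal{H}_k$ on a common vertex set contain a rainbow copy of $\mathcal{F}$ if their union contains a copy of $\mathcal{F}$ whose hyperedges lie in pairwise distinct $\mathcal{H}_i$'s. -}

module Defs where

open import Data.Nat using (ℕ; zero; suc; _+_; _*_; _∸_; _<_; _≤_)
open import Data.Nat.Combinatorics using (_C_)
open import Data.Bool using (Bool; true; false; _∨_) renaming (_∧_ to _∧B_)
open import Data.Fin using (Fin; toℕ) renaming (_<_ to _<ᶠ_)
open import Data.Fin.Subset using (Subset; ⁅_⁆; _∪_; ⋃; ∣_∣)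
open import Data.Vec using ([]; _∷_)
open import Data.List using (List; []; _∷_; map; length; filterᵇ; allFin; _++_)
open import Data.Nat.ListAction using (sum)
open import Data.Product using (Σ; _×_; _,_; proj₁; proj₂; ∃)
open import Data.Sum using (_⊎_; inj₁; inj₂)
open import Relation.Binary.PropositionalEquality using (_≡_)
open import Relation.Nullary using (¬_)
open import Function.Definitions using (Injective)

allSubsets : (n : ℕ) → List (Subset n)
allSubsets zero = [] ∷ []
allSubsets (suc n) = map (true ∷_) (allSubsets n) ++ map (false ∷_) (allSubsets n)

Hypergraph : ℕ → Set
Hypergraph n = Subset n → Bool

Uniform : {n : ℕ} → ℕ → Hypergraph n → Set
Uniform r H = ∀ s → H s ≡ true → ∣ s ∣ ≡ r

e : {n : ℕ} → Hypergraph n → ℕ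
e {n} H = length (filterᵇ H (allSubsets n))

-- Edges (pairs a < b) of the complete graph K_ℓ.
Pair : ℕ → Set
Pair ℓ = Σ (Fin ℓ × Fin ℓ) (λ ab → proj₁ ab <ᶠ proj₂ ab)

-- Vertex set of the r-expansion K_ℓ^{(r)+}: the ℓ core vertices plus
-- r-2 new vertices for each pair.
ExpVertex : ℕ → ℕ → Set
ExpVertex ℓ r = Fin ℓ ⊎ (Pair ℓ × Fin (r ∸ 2))

edgeImage : {n ℓ r : ℕ} → (ExpVertex ℓ r → Fin n) → Pair ℓ → Subset n
edgeImage {r = r} φ p@((a , b) , _) =
  ⁅ φ (inj₁ a) ⁆ ∪ (⁅ φ (inj₁ b) ⁆ ∪ ⋃ (map (λ j → ⁅ φ (inj₂ (p , j)) ⁆) (allFin (r ∸ 2))))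

RainbowExpansion : {n k : ℕ} → (ℓ r : ℕ) → (Fin k → Hypergraph n) → Set
RainbowExpansion {n} {k} ℓ r H =
  Σ (ExpVertex ℓ r → Fin n) λ φ → Injective _≡_ _≡_ φ ×
  Σ (Pair ℓ → Fin k) λ c → Injective _≡_ _≡_ c ×
  (∀ p → H (c p) (edgeImage {n} {ℓ} {r} φ p) ≡ true)

InUnion : {n k : ℕ} → (Fin k → Hypergraph n) → Subset n → Set
InUnion H s = ∃ λ i → H i s ≡ true

anyB : {k : ℕ} → (Fin k → Bool) → Bool
anyB {zero} f = false
anyB {suc k} f = f Data.Fin.zero ∨ anyB (λ i → f (Data.Fin.suc i))

unionH : {n k : ℕ} → (Fin k → Hypergraph n) → Hypergraph n
unionH H s = anyB (λ i → H i s)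

deleted : {n k : ℕ} → (Fin k → Hypergraph n) → Hypergraph n → ℕ
deleted {n} H D = length (filterᵇ (λ s → _∧B_ (unionH H s) (D s)) (allSubsets n))

totalEdges : {n k : ℕ} → (Fin k → Hypergraph n) → ℕ
totalEdges {k = k} H = sum (map (λ i → e (H i)) (allFin k))

{-# OPTIONS --safe #-}
-- Write m = C(ℓ,2) - 1.  Call a pair of vertices rich in colour i if its codegree in H_i exceeds B n^{r-3}, and
-- let w(a,b) be the number of colours in which ab is rich.  A rainbow K_ℓ of rich pairs extends greedily to a
-- rainbow expansion, so there is none.  Build a list of vertices in which each new vertex v has
-- Σ w(v,a) > m · (number of earlier a); a list of length ℓ would have so few pairs of small weight that its pairs
-- could be coloured greedily.  Hence the list gets stuck earlier, and deleting it costs at most m per pair on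
-- average, which gives Σ w(a,b) ≤ m n² + O(n) over ordered pairs.
--
-- Counting edges as ordered r-tuples, the lower bound on Σ e(H_i) then forces "x is an edge of H_i" to agree with
-- "x₁x₂ is rich in colour i" for all but O(n^{r-1}) tuples x.  As r ≥ 3 and edges are invariant under rotating
-- (x₁,x₂,x₃), richness of (a,b) and (b,c) mostly agree, so each H_i is almost complete or almost empty.  Comparing
-- totals, exactly m of them are almost complete, and by the ordering these are the first m.

module Submission where

open import Defs
open import Data.Nat hiding (compare)
open import Data.Nat.Properties
open import Data.Nat.Combinatorics using (_C_; nC1≡n; nCk+nC[k+1]≡[n+1]C[k+1])
open import Data.Nat.ListAction using (sum)
open import Data.Nat.ListAction.Properties using (sum-++; sum-↭)
open import Data.Nat.Tactic.RingSolver using (solve-∀)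
open import Data.Bool using (Bool; true; false; not; T; if_then_else_; _xor_) renaming (_∧_ to _∧B_)
open import Data.Bool.Properties using (T-≡; ∧-conicalˡ; ∧-conicalʳ; ∧-zeroʳ; ∧-identityʳ)
open import Data.Fin using (Fin; zero; suc; toℕ; fromℕ<) renaming (_≤_ to _≤ᶠ_; _<_ to _<ᶠ_)
open import Data.Fin.Properties using () renaming (_≟_ to _≟ᶠ_; <-cmp to <ᶠ-cmp)
open import Data.Fin.Subset using (Subset; ∣_∣; ⁅_⁆; _∪_; ⋃; ⊥)
open import Data.Fin.Subset.Properties using (∪-identityˡ)
open import Data.List using (List; []; _∷_; _++_; map; length; filterᵇ; allFin; cartesianProductWith; lookup; concatMap)
open import Data.List.Properties using (map-∘; map-++; map-tabulate; map-cong; length-tabulate; length-++; length-map)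
open import Data.List.Membership.Propositional using (_∈_; _∉_; lose; find)
open import Data.List.Membership.Propositional.Properties
  using (∈-∃++; ∈-++⁺ˡ; ∈-++⁺ʳ; ∈-++⁻; ∈-map⁺; ∈-allFin; ∈-concatMap⁺; ∈-lookup)
open import Data.List.Relation.Unary.Any using (here; there; any?)
open import Data.List.Relation.Unary.All using () renaming (lookup to All-lookup)
open import Data.List.Relation.Unary.All.Properties using (¬Any⇒All¬)
open import Data.List.Relation.Binary.Permutation.Propositional using (_↭_; ↭-refl; ↭-trans)
open import Data.List.Relation.Binary.Permutation.Propositional.Properties using (map⁺; shift; ↭-length; ++⁺ˡ)
open import Data.Vec using (Vec; []; _∷_; _[_]≔_; replicate; toList) renaming (lookup to lookupᵛ)
open import Data.Vec.Properties using ([]≔-commutes; lookup∘update; lookup∘update′; length-toList)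
open import Data.Vec.Membership.Propositional.Properties using (∈-toList⁺) renaming (∈-lookup to ∈ᵛ-lookup)
open import Data.Product using (Σ; _×_; _,_; ∃; proj₁; proj₂)
open import Data.Sum using (inj₁; inj₂)
open import Data.Empty using (⊥-elim)
open import Relation.Nullary using (¬_; does; yes; no)
open import Relation.Nullary.Decidable using (dec-true)
open import Relation.Binary.Definitions using (DecidableEquality; tri<; tri≈; tri>)
open import Relation.Binary.PropositionalEquality
open import Function using (_∘_)
open import Function.Bundles using (_⇔_; mk⇔; Equivalence)
open import Function.Definitions using (Injective)

private variable
  A B X : Set
  n k d : ℕ

-- Indicators and finite sums

ι : Bool → ℕ
ι b = if b then 1 else 0

ι≤1 : ∀ b → ι b ≤ 1
ι≤1 true  = ≤-refl
ι≤1 false = z≤n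

ι-∧ : ∀ a b → ι (a ∧B b) ≡ ι a * ι b
ι-∧ true  b = sym (+-identityʳ (ι b))
ι-∧ false b = refl

xor-triangle : ∀ a b c → ι (a xor c) ≤ ι (a xor b) + ι (b xor c)
xor-triangle true  true  c     = ≤-refl
xor-triangle false false c     = ≤-refl
xor-triangle true  false true  = z≤n
xor-triangle true  false false = ≤-refl
xor-triangle false true  true  = ≤-refl
xor-triangle false true  false = z≤n

xor-comm : ∀ a b → a xor b ≡ b xor a
xor-comm true  true  = refl
xor-comm true  false = refl
xor-comm false true  = refl
xor-comm false false = refl

∑ : List A → (A → ℕ) → ℕ
∑ xs f = sum (map f xs)

infix 5 ∑
syntax ∑ xs (λ x → t) = ∑[ x ∈ xs ] t

∑-cong : ∀ (xs : List A) {f g : A → ℕ} → (∀ x → f x ≡ g x) → ∑ xs f ≡ ∑ xs g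
∑-cong xs eq = cong sum (map-cong eq xs)

∑-∈ : ∀ {f : A → ℕ} {x xs} → x ∈ xs → f x ≤ ∑ xs f
∑-∈ (here refl) = m≤m+n _ _
∑-∈ (there x∈)  = ≤-trans (∑-∈ x∈) (m≤n+m _ _)

∑-mono-∈ : ∀ (xs : List A) {f g : A → ℕ} → (∀ {x} → x ∈ xs → f x ≤ g x) → ∑ xs f ≤ ∑ xs g
∑-mono-∈ []       le = z≤n
∑-mono-∈ (x ∷ xs) le = +-mono-≤ (le (here refl)) (∑-mono-∈ xs (le ∘ there))

∑-mono : ∀ (xs : List A) {f g : A → ℕ} → (∀ x → f x ≤ g x) → ∑ xs f ≤ ∑ xs g
∑-mono xs le = ∑-mono-∈ xs (λ {x} _ → le x)

∑-+ : ∀ (xs : List A) (f g : A → ℕ) → ∑[ x ∈ xs ] (f x + g x) ≡ ∑ xs f + ∑ xs g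
∑-+ []       f g = refl
∑-+ (x ∷ xs) f g rewrite ∑-+ xs f g = lemma (f x) (g x) (∑ xs f) (∑ xs g)
  where
  lemma : ∀ a b c d → a + b + (c + d) ≡ a + c + (b + d)
  lemma = solve-∀

∑-* : ∀ (xs : List A) c (f : A → ℕ) → ∑[ x ∈ xs ] (c * f x) ≡ c * ∑ xs f
∑-* []       c f = sym (*-zeroʳ c)
∑-* (x ∷ xs) c f rewrite ∑-* xs c f = sym (*-distribˡ-+ c (f x) (∑ xs f))

∑-const : ∀ (xs : List A) c → ∑[ _ ∈ xs ] c ≡ length xs * c
∑-const []       c = refl
∑-const (x ∷ xs) c = cong (c +_) (∑-const xs c)

∑-comm : ∀ (xs : List A) (ys : List B) (f : A → B → ℕ) →
         ∑[ x ∈ xs ] (∑[ y ∈ ys ] f x y) ≡ ∑[ y ∈ ys ] (∑[ x ∈ xs ] f x y)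
∑-comm []       ys f = sym (trans (∑-const ys 0) (*-zeroʳ (length ys)))
∑-comm (x ∷ xs) ys f rewrite ∑-comm xs ys f = sym (∑-+ ys (f x) (λ y → ∑ xs (λ x → f x y)))

∑-++ : ∀ (xs ys : List A) (f : A → ℕ) → ∑ (xs ++ ys) f ≡ ∑ xs f + ∑ ys f
∑-++ xs ys f = trans (cong sum (map-++ f xs ys)) (sum-++ (map f xs) (map f ys))

∑-map : ∀ (g : A → B) (xs : List A) (f : B → ℕ) → ∑ (map g xs) f ≡ ∑ xs (f ∘ g)
∑-map g xs f = cong sum (sym (map-∘ xs))

∑-↭ : ∀ {xs ys : List A} (f : A → ℕ) → xs ↭ ys → ∑ xs f ≡ ∑ ys f
∑-↭ f p = sum-↭ (map⁺ f p)

∑-allFin : ∀ n (f : Fin (suc n) → ℕ) → ∑ (allFin (suc n)) f ≡ f zero + ∑ (allFin n) (f ∘ suc)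
∑-allFin n f = cong (λ zs → f zero + sum zs) (trans (map-tabulate suc f) (sym (map-tabulate (λ i → i) (f ∘ suc))))

∑-lookup : ∀ (xs : List A) (f : A → ℕ) → ∑ (allFin (length xs)) (f ∘ lookup xs) ≡ ∑ xs f
∑-lookup []       f = refl
∑-lookup (x ∷ xs) f = trans (∑-allFin (length xs) _) (cong (f x +_) (∑-lookup xs f))

length-allFin : ∀ n → length (allFin n) ≡ n
length-allFin n = length-tabulate {n = n} (λ i → i)

∑-const-allFin : ∀ n c → ∑[ _ ∈ allFin n ] c ≡ n * c
∑-const-allFin n c = trans (∑-const (allFin n) c) (cong (_* c) (length-allFin n))

-- Serves for averaging and as a union bound: if `f` counts obstructions and `g` is an indicator,
-- the element found satisfies the indicator and meets no obstruction (`ι-pos`).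
∑-<⇒∃ : ∀ (xs : List A) (f g : A → ℕ) → ∑ xs f < ∑ xs g → ∃ λ x → x ∈ xs × f x < g x
∑-<⇒∃ (x ∷ xs) f g lt with f x <? g x
... | yes p = x , here refl , p
... | no ¬p with ∑-<⇒∃ xs f g (≰⇒> λ q → <⇒≱ lt (+-mono-≤ (≮⇒≥ ¬p) q))
...   | y , y∈ , q = y , there y∈ , q

length-filterᵇ : ∀ (p : A → Bool) xs → length (filterᵇ p xs) ≡ ∑[ x ∈ xs ] ι (p x)
length-filterᵇ p [] = refl
length-filterᵇ p (x ∷ xs) with p x
... | true  = cong suc (length-filterᵇ p xs)
... | false = length-filterᵇ p xs

-- Tuples of vertices

tuples : ∀ n d → List (Vec (Fin n) d)
tuples n zero    = [] ∷ []
tuples n (suc d) = cartesianProductWith _∷_ (allFin n) (tuples n d)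

∑-tuples : ∀ n d (f : Vec (Fin n) (suc d) → ℕ) →
           ∑ (tuples n (suc d)) f ≡ ∑[ x ∈ allFin n ] (∑[ y ∈ tuples n d ] f (x ∷ y))
∑-tuples n d f = go (allFin n)
  where
  go : ∀ xs → ∑ (cartesianProductWith _∷_ xs (tuples n d)) f ≡ ∑[ x ∈ xs ] (∑[ y ∈ tuples n d ] f (x ∷ y))
  go []       = refl
  go (x ∷ xs) = trans (∑-++ (map (x ∷_) (tuples n d)) _ f) (cong₂ _+_ (∑-map (x ∷_) (tuples n d) f) (go xs))

∑-const-tuples : ∀ n d c → ∑[ _ ∈ tuples n d ] c ≡ n ^ d * c
∑-const-tuples n zero    c = refl
∑-const-tuples n (suc d) c = begin
  ∑ (tuples n (suc d)) (λ _ → c)                ≡⟨ ∑-tuples n d _ ⟩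
  ∑ (allFin n) (λ _ → ∑ (tuples n d) (λ _ → c)) ≡⟨ ∑-const-allFin n _ ⟩
  n * ∑ (tuples n d) (λ _ → c)                  ≡⟨ cong (n *_) (∑-const-tuples n d c) ⟩
  n * (n ^ d * c)                               ≡⟨ *-assoc n (n ^ d) c ⟨
  n ^ suc d * c                                 ∎
  where open ≡-Reasoning

-- Insertion is a pointwise update, which suits induction on tuples; `insert-∪` and `⋃-verts`
-- connect it with the unions in `edgeImage`. Repeated entries collapse, hence the separate test
-- `distinct`.
verts : ∀ {d} → Vec (Fin n) d → Subset n
verts []      = ⊥
verts (x ∷ y) = verts y [ x ]≔ true

distinct : ∀ {d} → Vec (Fin n) d → Bool
distinct []      = true
distinct (x ∷ y) = not (lookupᵛ (verts y) x) ∧B distinct y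

-- Double counting of the pairs (t , x) with x ∈ t, where t = s ∪ {x}.
∑-insert : ∀ n (h : Subset n → ℕ) →
  ∑[ s ∈ allSubsets n ] (∑[ x ∈ allFin n ] ι (not (lookupᵛ s x)) * h (s [ x ]≔ true)) ≡
  ∑[ t ∈ allSubsets n ] ∣ t ∣ * h t
∑-insert zero    h = refl
∑-insert (suc n) h = begin
  ∑ (allSubsets (suc n)) F
    ≡⟨ ∑-++ (map (true ∷_) (allSubsets n)) _ F ⟩
  ∑ (map (true ∷_) (allSubsets n)) F + ∑ (map (false ∷_) (allSubsets n)) F
    ≡⟨ cong₂ _+_ (trans (∑-map (true ∷_) (allSubsets n) F) (∑-cong (allSubsets n) (λ s → ∑-allFin n (N (true ∷ s)))))
                 (trans (∑-map (false ∷_) (allSubsets n) F) (∑-cong (allSubsets n) (λ s → ∑-allFin n (N (false ∷ s))))) ⟩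
  ∑ (allSubsets n) (I (true ∷_)) + ∑ (allSubsets n) (λ s → 1 * h (true ∷ s) + I (false ∷_) s)
    ≡⟨ cong₂ _+_ (∑-insert n (h ∘ (true ∷_))) (∑-+ (allSubsets n) (λ s → 1 * h (true ∷ s)) (I (false ∷_))) ⟩
  ∑ (allSubsets n) (λ t → ∣ t ∣ * h (true ∷ t)) + (∑ (allSubsets n) (λ t → 1 * h (true ∷ t)) + ∑ (allSubsets n)
    (I (false ∷_)))
    ≡⟨ cong (λ z → ∑ (allSubsets n) (λ t → ∣ t ∣ * h (true ∷ t)) + (∑ (allSubsets n) (λ t → 1 * h (true ∷ t)) + z))
      (∑-insert n (h ∘ (false ∷_))) ⟩
  ∑ (allSubsets n) (λ t → ∣ t ∣ * h (true ∷ t)) + (∑ (allSubsets n) (λ t → 1 * h (true ∷ t)) + ∑ (allSubsets n)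
    (λ t → ∣ t ∣ * h (false ∷ t)))
    ≡⟨ +-assoc (∑ (allSubsets n) (λ t → ∣ t ∣ * h (true ∷ t))) _ _ ⟨
  ∑ (allSubsets n) (λ t → ∣ t ∣ * h (true ∷ t)) + ∑ (allSubsets n) (λ t → 1 * h (true ∷ t)) + ∑ (allSubsets n)
    (λ t → ∣ t ∣ * h (false ∷ t))
    ≡⟨ cong (_+ ∑ (allSubsets n) (λ t → ∣ t ∣ * h (false ∷ t))) (trans (sym (∑-+ (allSubsets n) _ _))
      (∑-cong (allSubsets n) (λ t → lemma ∣ t ∣ (h (true ∷ t))))) ⟩
  ∑ (allSubsets n) (λ t → suc ∣ t ∣ * h (true ∷ t)) + ∑ (allSubsets n) (λ t → ∣ t ∣ * h (false ∷ t))
    ≡⟨ cong₂ _+_ (∑-map (true ∷_) (allSubsets n) _) (∑-map (false ∷_) (allSubsets n) _) ⟨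
  ∑ (map (true ∷_) (allSubsets n)) G + ∑ (map (false ∷_) (allSubsets n)) G
    ≡⟨ ∑-++ (map (true ∷_) (allSubsets n)) _ G ⟨
  ∑ (allSubsets (suc n)) G ∎
  where
  open ≡-Reasoning
  N : Subset (suc n) → Fin (suc n) → ℕ
  N s x = ι (not (lookupᵛ s x)) * h (s [ x ]≔ true)
  F G : Subset (suc n) → ℕ
  F s = ∑ (allFin (suc n)) (N s)
  G t = ∣ t ∣ * h t
  I : (Subset n → Subset (suc n)) → Subset n → ℕ
  I c s = ∑[ x ∈ allFin n ] ι (not (lookupᵛ s x)) * h (c (s [ x ]≔ true))
  lemma : ∀ a b → a * b + 1 * b ≡ suc a * b
  lemma = solve-∀

∣insert∣ : ∀ (s : Subset n) x → lookupᵛ s x ≡ false → ∣ s [ x ]≔ true ∣ ≡ suc ∣ s ∣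
∣insert∣ (false ∷ s) zero    eq = refl
∣insert∣ (true  ∷ s) (suc x) eq = cong suc (∣insert∣ s x eq)
∣insert∣ (false ∷ s) (suc x) eq = ∣insert∣ s x eq

sized : ℕ → Subset n → Bool
sized d s = does (∣ s ∣ ≟ d)

sized⇒∣∣ : ∀ {d} (s : Subset n) → sized d s ≡ true → ∣ s ∣ ≡ d
sized⇒∣∣ {d = d} s eq = ≡ᵇ⇒≡ ∣ s ∣ d (subst T (sym eq) _)

∑-empty : ∀ n (h : Subset n → ℕ) → ∑[ s ∈ allSubsets n ] ι (sized 0 s) * h s ≡ h ⊥
∑-empty zero    h = trans (+-identityʳ _) (+-identityʳ _)
∑-empty (suc n) h = begin
  ∑ (allSubsets (suc n)) F
    ≡⟨ ∑-++ (map (true ∷_) (allSubsets n)) _ F ⟩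
  ∑ (map (true ∷_) (allSubsets n)) F + ∑ (map (false ∷_) (allSubsets n)) F
    ≡⟨ cong₂ _+_ (∑-map (true ∷_) (allSubsets n) F) (∑-map (false ∷_) (allSubsets n) F) ⟩
  ∑ (allSubsets n) (λ _ → 0) + ∑ (allSubsets n) (λ s → ι (sized 0 s) * h (false ∷ s))
    ≡⟨ cong₂ _+_ (trans (∑-const (allSubsets n) 0) (*-zeroʳ (length (allSubsets n)))) (∑-empty n (h ∘ (false ∷_))) ⟩
  h ⊥ ∎
  where
  open ≡-Reasoning
  F : Subset (suc n) → ℕ
  F s = ι (sized 0 s) * h s

sized-insert : ∀ d (s : Subset n) x → ι (sized d s) * ι (not (lookupᵛ s x)) ≡ ι (not (lookupᵛ s x)) * ι
  (sized (suc d) (s [ x ]≔ true))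
sized-insert d s x with lookupᵛ s x in eq
... | true  = *-zeroʳ (ι (sized d s))
... | false rewrite ∣insert∣ s x eq = trans (*-identityʳ _) (sym (+-identityʳ _))

-- The factorial builds up by induction: prepending a vertex outside the set reaches every
-- `(d + 1)`-set once for each of its elements, which is `∑-insert`.
∑-distinct : ∀ d (h : Subset n → ℕ) →
  ∑[ y ∈ tuples n d ] ι (distinct y) * h (verts y) ≡ d ! * (∑[ s ∈ allSubsets n ] ι (sized d s) * h s)
∑-distinct {n} zero    h = trans (+-identityʳ _) (cong (1 *_) (sym (∑-empty n h)))
∑-distinct {n} (suc d) h = begin
  ∑[ y ∈ tuples n (suc d) ] ι (distinct y) * h (verts y)
    ≡⟨ ∑-tuples n d _ ⟩
  ∑[ x ∈ allFin n ] (∑[ y ∈ tuples n d ] ι (not (lookupᵛ (verts y) x) ∧B distinct y) * h (verts y [ x ]≔ true))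
    ≡⟨ ∑-cong (allFin n) (λ x → ∑-cong (tuples n d) (λ y → trans (cong (_* h (verts y [ x ]≔ true))
      (ι-∧ (not (lookupᵛ (verts y) x)) (distinct y)))
         (lemma₁ (ι (not (lookupᵛ (verts y) x))) (ι (distinct y)) (h (verts y [ x ]≔ true))))) ⟩
  ∑[ x ∈ allFin n ] (∑[ y ∈ tuples n d ] ι (distinct y) * h′ x (verts y))
    ≡⟨ ∑-cong (allFin n) (λ x → ∑-distinct d (h′ x)) ⟩
  ∑[ x ∈ allFin n ] d ! * (∑[ s ∈ allSubsets n ] ι (sized d s) * h′ x s)
    ≡⟨ ∑-* (allFin n) (d !) _ ⟩
  d ! * (∑[ x ∈ allFin n ] (∑[ s ∈ allSubsets n ] ι (sized d s) * h′ x s))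
    ≡⟨ cong (d ! *_) (∑-comm (allFin n) (allSubsets n) _) ⟩
  d ! * (∑[ s ∈ allSubsets n ] (∑[ x ∈ allFin n ] ι (sized d s) * h′ x s))
    ≡⟨ cong (d ! *_) (∑-cong (allSubsets n) (λ s → ∑-cong (allFin n) (λ x → lemma₂ s x))) ⟩
  d ! * (∑[ s ∈ allSubsets n ] (∑[ x ∈ allFin n ] ι (not (lookupᵛ s x)) *
    (ι (sized (suc d) (s [ x ]≔ true)) * h (s [ x ]≔ true))))
    ≡⟨ cong (d ! *_) (∑-insert n (λ t → ι (sized (suc d) t) * h t)) ⟩
  d ! * (∑[ t ∈ allSubsets n ] ∣ t ∣ * (ι (sized (suc d) t) * h t))
    ≡⟨ cong (d ! *_) (trans (∑-cong (allSubsets n) lemma₃) (∑-* (allSubsets n) (suc d) _)) ⟩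
  d ! * (suc d * (∑[ t ∈ allSubsets n ] ι (sized (suc d) t) * h t))
    ≡⟨ lemma₄ (d !) d (∑[ t ∈ allSubsets n ] ι (sized (suc d) t) * h t) ⟩
  suc d ! * (∑[ t ∈ allSubsets n ] ι (sized (suc d) t) * h t) ∎
  where
  open ≡-Reasoning
  h′ : Fin n → Subset n → ℕ
  h′ x s = ι (not (lookupᵛ s x)) * h (s [ x ]≔ true)
  lemma₁ : ∀ a b c → a * b * c ≡ b * (a * c)
  lemma₁ = solve-∀
  lemma₂ : ∀ s x → ι (sized d s) * h′ x s ≡ ι (not (lookupᵛ s x)) * (ι (sized (suc d) (s [ x ]≔ true)) * h (s [ x ]≔ true))
  lemma₂ s x = trans (sym (*-assoc (ι (sized d s)) _ _))
    (trans (cong (_* h (s [ x ]≔ true)) (sized-insert d s x)) (*-assoc (ι (not (lookupᵛ s x))) _ _))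
  lemma₃ : ∀ t → ∣ t ∣ * (ι (sized (suc d) t) * h t) ≡ suc d * (ι (sized (suc d) t) * h t)
  lemma₃ t with sized (suc d) t in eq
  ... | true  = cong (_* (1 * h t)) (sized⇒∣∣ t eq)
  ... | false = trans (*-zeroʳ ∣ t ∣) (sym (*-zeroʳ (suc d)))
  lemma₄ : ∀ a d s → a * (suc d * s) ≡ suc d * a * s
  lemma₄ = solve-∀

-- Binomial coefficients

-- This is `(k + 1) C(n, k + 1) = (n - k) C(n, k)` with the subtraction moved across, proved from
-- Pascal's rule.
absorption : ∀ n k → suc k * (n C suc k) + k * (n C k) ≡ n * (n C k)
absorption zero    zero    = refl
absorption zero    (suc k) = trans (cong₂ _+_ (*-zeroʳ (suc (suc k))) (*-zeroʳ (suc k))) refl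
absorption (suc n) zero    = trans (cong (λ z → 1 * z + 0) (nC1≡n (suc n))) (lemma n)
  where
  lemma : ∀ n → 1 * suc n + 0 ≡ suc n * 1
  lemma = solve-∀
absorption (suc n) (suc k)
  rewrite sym (nCk+nC[k+1]≡[n+1]C[k+1] n (suc k)) | sym (nCk+nC[k+1]≡[n+1]C[k+1] n k) =
  trans (lemma₁ k (n C k) (n C suc k) (n C suc (suc k)))
    (trans (cong₂ (λ u v → u + v + n C suc k + n C k) (absorption n (suc k)) (absorption n k))
      (lemma₂ n (n C k) (n C suc k)))
  where
  lemma₁ : ∀ k a b c → suc (suc k) * (b + c) + suc k * (a + b) ≡ suc (suc k) * c + suc k * b + (suc k * b + k * a) + b + a
  lemma₁ = solve-∀
  lemma₂ : ∀ n a b → n * b + n * a + b + a ≡ suc n * (a + b)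
  lemma₂ = solve-∀

k!nCk≤n^k : ∀ n k → k ! * (n C k) ≤ n ^ k
k!nCk≤n^k n zero    = ≤-refl
k!nCk≤n^k n (suc k) = begin
  suc k ! * (n C suc k)                        ≡⟨ lemma₁ k (k !) (n C suc k) ⟩
  k ! * (suc k * (n C suc k))                  ≤⟨ *-monoʳ-≤ (k !) (m≤m+n _ _) ⟩
  k ! * (suc k * (n C suc k) + k * (n C k))    ≡⟨ cong (k ! *_) (absorption n k) ⟩
  k ! * (n * (n C k))                          ≡⟨ lemma₂ (k !) n (n C k) ⟩
  n * (k ! * (n C k))                          ≤⟨ *-monoʳ-≤ n (k!nCk≤n^k n k) ⟩
  n ^ suc k ∎
  where
  open ≤-Reasoning
  lemma₁ : ∀ k f c → suc k * f * c ≡ f * (suc k * c)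
  lemma₁ = solve-∀
  lemma₂ : ∀ a b c → a * (b * c) ≡ b * (a * c)
  lemma₂ = solve-∀

-- With `K = suc k`, multiplying by `n` and applying `absorption` adds an error `K n^K` to the old
-- `K² n^K`, and `K + K² ≤ (K + 1)²`.
n^k≤k!nCk : ∀ n k → n ^ suc k ≤ suc k ! * (n C suc k) + suc k * suc k * n ^ k
n^k≤k!nCk n zero = ≤-trans (≤-reflexive (trans (*-identityʳ n) (sym (trans (*-identityˡ _) (nC1≡n n))))) (m≤m+n _ _)
n^k≤k!nCk n (suc k) = begin
  n * n ^ suc k
    ≤⟨ *-monoʳ-≤ n (n^k≤k!nCk n k) ⟩
  n * (F * c + K * K * n ^ k)
    ≡⟨ lemma₁ n F c K (n ^ k) ⟩
  F * (n * c) + K * K * (n * n ^ k)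
    ≡⟨ cong (λ z → F * z + K * K * (n * n ^ k)) (sym (absorption n K)) ⟩
  F * (suc K * c′ + K * c) + K * K * (n * n ^ k)
    ≡⟨ lemma₂ F K c c′ (n * n ^ k) ⟩
  suc K * F * c′ + (K * (F * c) + K * K * (n * n ^ k))
    ≤⟨ +-monoʳ-≤ (suc K * F * c′) (+-monoˡ-≤ (K * K * (n * n ^ k)) (*-monoʳ-≤ K (k!nCk≤n^k n K))) ⟩
  suc K * F * c′ + (K * (n * n ^ k) + K * K * (n * n ^ k))
    ≤⟨ +-monoʳ-≤ (suc K * F * c′) (≤-trans (m≤m+n _ (suc K * (n * n ^ k))) (≤-reflexive (lemma₃ K (n * n ^ k)))) ⟩
  suc K * F * c′ + suc K * suc K * n ^ suc k ∎
  where
  open ≤-Reasoning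
  K = suc k
  F = suc k !
  c = n C suc k
  c′ = n C suc (suc k)
  lemma₁ : ∀ n F c K p → n * (F * c + K * K * p) ≡ F * (n * c) + K * K * (n * p)
  lemma₁ = solve-∀
  lemma₂ : ∀ F K c c′ p → F * (suc K * c′ + K * c) + K * K * p ≡ suc K * F * c′ + (K * (F * c) + K * K * p)
  lemma₂ = solve-∀
  lemma₃ : ∀ K p → K * p + K * K * p + suc K * p ≡ suc K * suc K * p
  lemma₃ = solve-∀

[1+n]C2 : ∀ n → suc n C 2 ≡ n + n C 2
[1+n]C2 n = trans (sym (nCk+nC[k+1]≡[n+1]C[k+1] n 1)) (cong (_+ n C 2) (nC1≡n n))

2*nC2+n : ∀ n → 2 * (n C 2) + n ≡ n * n
2*nC2+n zero    = refl
2*nC2+n (suc n) = begin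
  2 * (suc n C 2) + suc n           ≡⟨ cong (λ z → 2 * z + suc n) ([1+n]C2 n) ⟩
  2 * (n + n C 2) + suc n           ≡⟨ lemma₁ n (n C 2) ⟩
  (2 * (n C 2) + n) + (2 * n + 1)   ≡⟨ cong (_+ (2 * n + 1)) (2*nC2+n n) ⟩
  n * n + (2 * n + 1)               ≡⟨ lemma₂ n ⟩
  suc n * suc n                     ∎
  where
  open ≡-Reasoning
  lemma₁ : ∀ n c → 2 * (n + c) + suc n ≡ 2 * c + n + (2 * n + 1)
  lemma₁ = solve-∀
  lemma₂ : ∀ n → n * n + (2 * n + 1) ≡ suc n * suc n
  lemma₂ = solve-∀

-- The greedy argument

-- The newest vertex is the head. Starting from one vertex rather than none keeps the list nonempty,
-- so that deleting it makes progress in `weight-bound`.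
data Dense (w : A → A → ℕ) (m : ℕ) : List A → Set where
  [-]  : ∀ {v} → Dense w m (v ∷ [])
  cons : ∀ {v xs} → m * length xs < ∑ xs (w v) → Dense w m xs → Dense w m (v ∷ xs)

weight : (A → A → ℕ) → List A → List A → ℕ
weight w xs ys = ∑[ x ∈ xs ] ∑ ys (w x)

weight-++ : ∀ (w : A → A → ℕ) → (∀ x y → w x y ≡ w y x) → ∀ xs ys →
            weight w (xs ++ ys) (xs ++ ys) ≡ weight w xs xs + 2 * weight w ys xs + weight w ys ys
weight-++ w w-sym xs ys = begin
  weight w (xs ++ ys) (xs ++ ys)
    ≡⟨ ∑-++ xs ys _ ⟩
  weight w xs (xs ++ ys) + weight w ys (xs ++ ys)
    ≡⟨ cong₂ _+_ (split xs) (split ys) ⟩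
  weight w xs xs + weight w xs ys + (weight w ys xs + weight w ys ys)
    ≡⟨ cong (λ z → weight w xs xs + z + (weight w ys xs + weight w ys ys)) flip ⟩
  weight w xs xs + weight w ys xs + (weight w ys xs + weight w ys ys)
    ≡⟨ lemma (weight w xs xs) (weight w ys xs) (weight w ys ys) ⟩
  weight w xs xs + 2 * weight w ys xs + weight w ys ys ∎
  where
  open ≡-Reasoning
  split : ∀ zs → weight w zs (xs ++ ys) ≡ weight w zs xs + weight w zs ys
  split zs = trans (∑-cong zs (λ z → ∑-++ xs ys (w z))) (∑-+ zs _ _)
  flip : weight w xs ys ≡ weight w ys xs
  flip = trans (∑-comm xs ys w) (∑-cong ys (λ y → ∑-cong xs (λ x → w-sym x y)))
  lemma : ∀ a b c → a + b + (b + c) ≡ a + 2 * b + c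
  lemma = solve-∀

weight-↭ : ∀ (w : A → A → ℕ) {xs ys} → xs ↭ ys → weight w xs xs ≡ weight w ys ys
weight-↭ w {xs} {ys} p = trans (∑-↭ _ p) (∑-cong ys (λ x → ∑-↭ (w x) p))

module _ (w : A → A → ℕ) (m ℓ : ℕ) (short : ∀ {xs} → Dense w m xs → length xs ≢ ℓ) where

  Saturated : List A → List A → Set
  Saturated xs ys = ∀ {y} → y ∈ ys → ∑ xs (w y) ≤ m * length xs

  -- `d` is the length still missing from `ℓ`. While some vertex of `ys` is joined too heavily to
  -- the list, it is moved there; doing so until `d` is zero would contradict `short`.
  saturate : ∀ d {xs} ys → Dense w m xs → length xs + d ≡ ℓ →
             Σ (List A) λ xs′ → Σ (List A) λ ys′ →
             xs ++ ys ↭ xs′ ++ ys′ × 0 < length xs′ × length xs′ ≤ ℓ × Saturated xs′ ys′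
  saturate zero    ys D eq = ⊥-elim (short D (trans (sym (+-identityʳ _)) eq))
  saturate (suc d) {xs} ys D eq with any? (λ y → m * length xs <? ∑ xs (w y)) ys
  ... | no none = xs , ys , ↭-refl , nonempty D , ≤-trans (m≤m+n _ _) (≤-reflexive eq) ,
                  λ y∈ → ≮⇒≥ (All-lookup (¬Any⇒All¬ ys none) y∈)
    where
    nonempty : ∀ {xs} → Dense w m xs → 0 < length xs
    nonempty [-]        = z<s
    nonempty (cons _ _) = z<s
  ... | yes some with find some
  ...   | y , y∈ , dense with ∈-∃++ y∈
  ...     | as , bs , refl
    with xs′ , ys′ , p , rest ← saturate d (as ++ bs) (cons dense D) (trans (sym (+-suc _ d)) eq) =
    xs′ , ys′ , ↭-trans (↭-trans (++⁺ˡ xs (shift y as bs)) (shift y xs (as ++ bs))) p , rest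

  -- Split off a saturated list of `a ≤ ℓ` vertices, leaving `b`. Pairs inside it weigh at most
  -- `k a² ≤ k ℓ a`, cross pairs at most `2 m a b` by saturation, and the rest is handled by
  -- induction.
  weight-bound : ∀ k → 0 < ℓ → (∀ x y → w x y ≡ w y x) → (∀ x y → w x y ≤ k) →
                 ∀ xs → weight w xs xs ≤ m * (length xs * length xs) + k * ℓ * length xs
  weight-bound k 0<ℓ w-sym w≤k xs = go (length xs) xs ≤-refl
    where
    open ≤-Reasoning
    arith₁ : ∀ k m a b → a * (a * k) + 2 * (b * (m * a)) ≡ 2 * (b * (m * a)) + k * a * a
    arith₁ = solve-∀
    arith₂ : ∀ k l m a b → 2 * (b * (m * a)) + k * l * a + (m * (b * b) + k * l * b) + m * (a * a) ≡ m *
      ((a + b) * (a + b)) + k * l * (a + b)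
    arith₂ = solve-∀
    go : ∀ N xs → length xs ≤ N → weight w xs xs ≤ m * (length xs * length xs) + k * ℓ * length xs
    go _       []       _ = z≤n
    go (suc N) (x ∷ xs) (s≤s len)
      with as , bs , p , 0<a , a≤ℓ , sat ← saturate (pred ℓ) xs ([-] {v = x}) (suc-pred ℓ {{>-nonZero 0<ℓ}}) = begin
      weight w (x ∷ xs) (x ∷ xs)
        ≡⟨ trans (weight-↭ w p) (weight-++ w w-sym as bs) ⟩
      weight w as as + 2 * weight w bs as + weight w bs bs
        ≤⟨ +-mono-≤ (+-mono-≤ A≤ (*-monoʳ-≤ 2 B≤)) (go N bs b≤N) ⟩
      a * (a * k) + 2 * (b * (m * a)) + (m * (b * b) + k * ℓ * b)
        ≡⟨ cong (_+ (m * (b * b) + k * ℓ * b)) (arith₁ k m a b) ⟩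
      2 * (b * (m * a)) + k * a * a + (m * (b * b) + k * ℓ * b)
        ≤⟨ +-monoˡ-≤ _ (+-monoʳ-≤ (2 * (b * (m * a))) (*-monoˡ-≤ a (*-monoʳ-≤ k a≤ℓ))) ⟩
      2 * (b * (m * a)) + k * ℓ * a + (m * (b * b) + k * ℓ * b)
        -- The spare `m * (a * a)` completes the square `m (a + b)²`.
        ≤⟨ m≤m+n _ _ ⟩
      2 * (b * (m * a)) + k * ℓ * a + (m * (b * b) + k * ℓ * b) + m * (a * a)
        ≡⟨ arith₂ k ℓ m a b ⟩
      m * ((a + b) * (a + b)) + k * ℓ * (a + b)
        ≡⟨ cong (λ z → m * (z * z) + k * ℓ * z) (sym len≡) ⟩
      m * (length (x ∷ xs) * length (x ∷ xs)) + k * ℓ * length (x ∷ xs) ∎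
      where
      a = length as
      b = length bs
      len≡ : length (x ∷ xs) ≡ a + b
      len≡ = trans (↭-length p) (length-++ as)
      b≤N : b ≤ N
      b≤N = s≤s⁻¹ (≤-trans (+-monoˡ-≤ b 0<a) (≤-trans (≤-reflexive (sym len≡)) (s≤s len)))
      A≤ : weight w as as ≤ a * (a * k)
      A≤ = ≤-trans (∑-mono as (λ x → ≤-trans (∑-mono as (w≤k x)) (≤-reflexive (∑-const as k))))
        (≤-reflexive (∑-const as (a * k)))
      B≤ : weight w bs as ≤ b * (m * a)
      B≤ = ≤-trans (∑-mono-∈ bs sat) (≤-reflexive (∑-const bs (m * a)))

-- Few light pairs in a dense list

-- Pairs at the head come first, then the shifted pairs of the tail, matching the growth of a
-- `Dense` list at its head; `lightPairs-∷` relies on this order.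
pairs : ∀ ℓ → List (Pair ℓ)
pairs zero    = []
pairs (suc ℓ) = map (λ b → (zero , suc b) , z<s) (allFin ℓ) ++
                map (λ ((a , b) , a<b) → (suc a , suc b) , s<s a<b) (pairs ℓ)

∈-pairs : ∀ {ℓ} (p : Pair ℓ) → p ∈ pairs ℓ
∈-pairs {suc ℓ} ((zero  , suc b) , z<s)       = ∈-++⁺ˡ (∈-map⁺ _ (∈-allFin b))
∈-pairs {suc ℓ} ((suc a , suc b) , s≤s a<b) = ∈-++⁺ʳ _ (∈-map⁺ _ (∈-pairs ((a , b) , a<b)))

length-pairs : ∀ ℓ → length (pairs ℓ) ≡ ℓ C 2
length-pairs zero    = refl
length-pairs (suc ℓ) = trans (length-++ (map _ (allFin ℓ)))
  (trans (cong₂ _+_ (trans (length-map _ (allFin ℓ)) (length-allFin ℓ)) (trans (length-map _ (pairs ℓ)) (length-pairs ℓ)))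
         (sym ([1+n]C2 ℓ)))

pairWeight : (A → A → ℕ) → (xs : List A) → Pair (length xs) → ℕ
pairWeight w xs ((a , b) , _) = w (lookup xs a) (lookup xs b)

lightPairs : (A → A → ℕ) → ℕ → List A → ℕ
lightPairs w j xs = ∑[ p ∈ pairs (length xs) ] ι (pairWeight w xs p <ᵇ j)

lightPairs-∷ : ∀ (w : A → A → ℕ) j v xs →
               lightPairs w j (v ∷ xs) ≡ (∑[ x ∈ xs ] ι (w v x <ᵇ j)) + lightPairs w j xs
lightPairs-∷ w j v xs = trans (∑-++ (map _ (allFin (length xs))) _ _)
  (cong₂ _+_ (trans (∑-map _ (allFin (length xs)) _) (∑-lookup xs (λ x → ι (w v x <ᵇ j)))) (∑-map _ (pairs (length xs)) _))

<ᵇ-true : ∀ {a b} → (a <ᵇ b) ≡ true → a < b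
<ᵇ-true {a} {b} eq = <ᵇ⇒< a b (subst T (sym eq) _)

module _ (w : A → A → ℕ) (m q j t : ℕ) (w≤ : ∀ x y → w x y ≤ m + q) (jt : j + t ≡ suc (m + q)) where

  -- Here `t = m + q + 1 - j` is the least amount by which a pair lighter than `j` falls short of
  -- the maximum `m + q`. The row exceeds `m` per entry on average, so its shortfall is less than
  -- `q` per entry.
  row-bound : ∀ v xs → m * length xs < ∑ xs (w v) → suc ((∑[ x ∈ xs ] ι (w v x <ᵇ j)) * t) ≤ length xs * q
  row-bound v xs dense = +-cancelʳ-≤ (m * length xs) _ _ (begin
    suc (r * t) + m * length xs               ≡⟨ arith₁ (r * t) (m * length xs) ⟩
    r * t + suc (m * length xs)               ≤⟨ +-monoʳ-≤ (r * t) dense ⟩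
    r * t + ∑ xs (w v)                        ≡⟨ cong (_+ ∑ xs (w v)) (trans (*-comm r t) (sym (∑-* xs t _))) ⟩
    (∑[ x ∈ xs ] t * ι (w v x <ᵇ j)) + ∑ xs (w v)  ≡⟨ ∑-+ xs _ _ ⟨
    ∑[ x ∈ xs ] (t * ι (w v x <ᵇ j) + w v x)  ≤⟨ ∑-mono xs pointwise ⟩
    ∑[ _ ∈ xs ] (m + q)                       ≡⟨ ∑-const xs (m + q) ⟩
    length xs * (m + q)                       ≡⟨ arith₂ (length xs) m q ⟩
    length xs * q + m * length xs             ∎)
    where
    open ≤-Reasoning
    r = ∑[ x ∈ xs ] ι (w v x <ᵇ j)
    arith₁ : ∀ a b → suc a + b ≡ a + suc b
    arith₁ = solve-∀
    arith₂ : ∀ a b c → a * (b + c) ≡ a * c + b * a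
    arith₂ = solve-∀
    pointwise : ∀ x → t * ι (w v x <ᵇ j) + w v x ≤ m + q
    pointwise x with w v x <ᵇ j in eq
    ... | false rewrite *-zeroʳ t = w≤ v x
    ... | true  = s≤s⁻¹ (begin
      suc (t * 1 + w v x)  ≡⟨ arith₁′ t (w v x) ⟩
      suc (w v x) + t      ≤⟨ +-monoˡ-≤ t (<ᵇ-true eq) ⟩
      j + t                ≡⟨ jt ⟩
      suc (m + q)          ∎)
      where
      arith₁′ : ∀ t u → suc (t * 1 + u) ≡ suc u + t
      arith₁′ = solve-∀

  -- Sums `row-bound` over all rows; the term `length xs` collects the one unit of strictness that
  -- each row contributes.
  lightPairs-bound : ∀ v xs → Dense w m (v ∷ xs) → lightPairs w j (v ∷ xs) * t + length xs ≤ q * (length (v ∷ xs) C 2)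
  lightPairs-bound v []       [-] = z≤n
  lightPairs-bound v (u ∷ xs) (cons dense D) = begin
    lightPairs w j (v ∷ u ∷ xs) * t + suc (length xs)
      ≡⟨ cong (λ z → z * t + suc (length xs)) (lightPairs-∷ w j v (u ∷ xs)) ⟩
    (r + lightPairs w j (u ∷ xs)) * t + suc (length xs)
      ≡⟨ arith r (lightPairs w j (u ∷ xs)) t (length xs) ⟩
    suc (r * t) + (lightPairs w j (u ∷ xs) * t + length xs)
      ≤⟨ +-mono-≤ (row-bound v (u ∷ xs) dense) (lightPairs-bound u xs D) ⟩
    L * q + q * (L C 2)
      ≡⟨ cong (_+ q * (L C 2)) (*-comm L q) ⟩
    q * L + q * (L C 2)
      ≡⟨ *-distribˡ-+ q L (L C 2) ⟨
    q * (L + L C 2)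
      ≡⟨ cong (q *_) ([1+n]C2 L) ⟨
    q * (suc L C 2) ∎
    where
    open ≤-Reasoning
    L = length (u ∷ xs)
    r = ∑[ x ∈ u ∷ xs ] ι (w v x <ᵇ j)
    arith : ∀ r p t l → (r + p) * t + suc l ≡ suc (r * t) + (p * t + l)
    arith = solve-∀

  -- The hypothesis says `(length xs - 1) q ≤ t` without subtraction. By `row-bound` even the
  -- longest row then has a shortfall below `t`, the least cost of one light pair.
  no-lightPairs : ∀ xs → Dense w m xs → length xs * q ≤ t + q → lightPairs w j xs ≡ 0
  no-lightPairs (v ∷ []) [-] _ = refl
  no-lightPairs (v ∷ xs) (cons dense D) le =
    trans (lightPairs-∷ w j v xs) (cong₂ _+_ row≡0 (no-lightPairs xs D (≤-trans le′ (m≤m+n t q))))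
    where
    le′ : length xs * q ≤ t
    le′ = +-cancelˡ-≤ q _ _ (≤-trans le (≤-reflexive (+-comm t q)))
    row≡0 : (∑[ x ∈ xs ] ι (w v x <ᵇ j)) ≡ 0
    row≡0 with ∑[ x ∈ xs ] ι (w v x <ᵇ j) | row-bound v xs dense
    ... | zero  | _ = refl
    ... | suc r | b = ⊥-elim (<⇒≱ (≤-trans (s≤s (m≤m+n t (r * t))) b) le′)

-- With M = m + 1 = C(ℓ,2) and t = m + q + 1 - j, summing the rows of a dense list gives P t < q M for the
-- number P of pairs lighter than j.  For q ≤ j ≤ M this excludes P ≥ j, because j t - q M = (j - q) (M - j);
-- for j < q even a single light pair in a row costs more than that row can spare, so P = 0.
few-lightPairs : ∀ (w : A → A → ℕ) {m q} xs → Dense w m xs → (∀ x y → w x y ≤ m + q) →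
                 suc m ≡ length xs C 2 → 2 * q ≤ length xs → ∀ j → 0 < j → lightPairs w j xs < j
few-lightPairs w {m} {q} xs@(x₀ ∷ xs₀) D w≤ eq 2q≤ℓ j 0<j with j ≤? suc m | j <? q
... | no j≰M | _ = ≤-<-trans bound (≰⇒> j≰M)
  where
  open ≤-Reasoning
  bound : lightPairs w j xs ≤ suc m
  bound = begin
    lightPairs w j xs                          ≤⟨ ∑-mono (pairs (length xs)) (λ p → ι≤1 (pairWeight w xs p <ᵇ j)) ⟩
    ∑ (pairs (length xs)) (λ _ → 1)            ≡⟨ trans (∑-const (pairs (length xs)) 1) (*-identityʳ _) ⟩
    length (pairs (length xs))                 ≡⟨ trans (length-pairs (length xs)) (sym eq) ⟩
    suc m                                      ∎
... | yes j≤M | yes j<q = subst (_< j) (sym (no-lightPairs w m q j t w≤ jt xs D ℓq≤)) 0<j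
  where
  open ≤-Reasoning
  ℓ = length xs
  t = suc (m + q) ∸ j
  jt : j + t ≡ suc (m + q)
  jt = m+[n∸m]≡n (≤-trans j≤M (s≤s (m≤m+n m q)))
  M≤t : suc m ≤ t
  M≤t = +-cancelˡ-≤ j _ _ (begin
    j + suc m     ≤⟨ +-monoˡ-≤ (suc m) (<⇒≤ j<q) ⟩
    q + suc m     ≡⟨ +-comm q (suc m) ⟩
    suc (m + q)   ≡⟨ jt ⟨
    j + t         ∎)
  -- 2 (ℓ-1) q ≤ (ℓ-1) ℓ = 2 M
  ℓq≤ : ℓ * q ≤ t + q
  ℓq≤ = ≤-trans (≤-reflexive (+-comm q (length xs₀ * q))) (+-monoˡ-≤ q (≤-trans (*-cancelˡ-≤ 2 (+-cancelʳ-≤ ℓ _ _ (begin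
    2 * (length xs₀ * q) + ℓ    ≡⟨ arith₁ (length xs₀) q ⟩
    length xs₀ * (2 * q) + ℓ    ≤⟨ +-monoˡ-≤ ℓ (*-monoʳ-≤ (length xs₀) 2q≤ℓ) ⟩
    length xs₀ * ℓ + ℓ          ≡⟨ +-comm (length xs₀ * ℓ) ℓ ⟩
    ℓ * ℓ                       ≡⟨ 2*nC2+n ℓ ⟨
    2 * (ℓ C 2) + ℓ             ≡⟨ cong (λ z → 2 * z + ℓ) eq ⟨
    2 * suc m + ℓ               ∎))) M≤t))
    where
    arith₁ : ∀ l q → 2 * (l * q) + suc l ≡ l * (2 * q) + suc l
    arith₁ = solve-∀
... | yes j≤M | no j≮q = ≰⇒> contra
  where
  open ≤-Reasoning
  u = j ∸ q
  v = suc m ∸ j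
  qu : q + u ≡ j
  qu = m+[n∸m]≡n (≮⇒≥ j≮q)
  jv : j + v ≡ suc m
  jv = m+[n∸m]≡n j≤M
  jt : j + (v + q) ≡ suc (m + q)
  jt = trans (sym (+-assoc j v q)) (cong (_+ q) jv)
  -- The total is strict only if there is at least one row; a single vertex is ruled out because
  -- `1 C 2` is zero while `suc m` is not.
  1≤ : 1 ≤ length xs₀
  1≤ = n≢0⇒n>0 λ ℓ≡1 → 1+n≢0 (trans eq (cong (λ l → suc l C 2) ℓ≡1))
  contra : ¬ j ≤ lightPairs w j xs
  contra le = <⇒≱ (n<1+n (q * (q + u + v) + u * v)) (begin
    suc (q * (q + u + v) + u * v)                 ≡⟨ arith q u v ⟩
    (q + u) * (v + q) + 1                         ≡⟨ cong (λ z → z * (v + q) + 1) qu ⟩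
    j * (v + q) + 1                               ≤⟨ +-mono-≤ (*-monoˡ-≤ (v + q) le) 1≤ ⟩
    lightPairs w j xs * (v + q) + length xs₀      ≤⟨ lightPairs-bound w m q j (v + q) w≤ jt x₀ xs₀ D ⟩
    q * (length xs C 2)                           ≡⟨ cong (q *_) (trans (sym eq) (trans (sym jv) (cong (_+ v) (sym qu)))) ⟩
    q * (q + u + v)                               ≤⟨ m≤m+n _ _ ⟩
    q * (q + u + v) + u * v                       ∎)
    where
    arith : ∀ q u v → suc (q * (q + u + v) + u * v) ≡ (q + u) * (v + q) + 1
    arith = solve-∀

-- Tuples avoiding a list of vertices

occurrences : List (Fin n) → Fin n → ℕ
occurrences F x = ∑[ f ∈ F ] ι (does (x ≟ᶠ f))

occurrences≡0⇒∉ : ∀ (F : List (Fin n)) {x} → occurrences F x ≡ 0 → x ∉ F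
occurrences≡0⇒∉ (f ∷ F) {x} eq x∈ with x ≟ᶠ f
... | no x≢f with x∈
...   | here x≡f = x≢f x≡f
...   | there x∈F = occurrences≡0⇒∉ F eq x∈F

∑-occurrences : ∀ (F : List (Fin n)) → ∑ (allFin n) (occurrences F) ≡ length F
∑-occurrences {n} F = trans (∑-comm (allFin n) F _) (trans (∑-cong F once) (trans (∑-const F 1) (*-identityʳ _)))
  where
  once : ∀ {n} (f : Fin n) → ∑[ x ∈ allFin n ] ι (does (x ≟ᶠ f)) ≡ 1
  once {suc n} zero    = trans (∑-allFin n (λ x → ι (does (x ≟ᶠ zero)))) (cong suc (trans (∑-const-allFin n 0) (*-zeroʳ n)))
  once {suc n} (suc f) = trans (∑-allFin n (λ x → ι (does (x ≟ᶠ suc f)))) (once f)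

hits : List (Fin n) → Vec (Fin n) d → ℕ
hits F []      = 0
hits F (x ∷ y) = occurrences F x + hits F y

hits≡0⇒∉ : ∀ (F : List (Fin n)) (y : Vec (Fin n) d) → hits F y ≡ 0 → ∀ j → lookupᵛ y j ∉ F
hits≡0⇒∉ F (x ∷ y) eq zero    = occurrences≡0⇒∉ F (m+n≡0⇒m≡0 _ eq)
hits≡0⇒∉ F (x ∷ y) eq (suc j) = hits≡0⇒∉ F y (m+n≡0⇒n≡0 _ eq) j

-- Each of the `suc d` positions takes each entry of `F` in exactly `n ^ d` tuples. A bounded list
-- thus meets only order `n ^ d` tuples, which the completions of a rich pair outnumber.
∑-hits : ∀ (F : List (Fin n)) d → ∑[ y ∈ tuples n (suc d) ] hits F y ≡ suc d * length F * n ^ d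
∑-hits {n} F zero = begin
  ∑ (tuples n 1) (hits F)                            ≡⟨ ∑-tuples n 0 (hits F) ⟩
  ∑ (allFin n) (λ x → occurrences F x + 0 + 0)       ≡⟨ ∑-cong (allFin n) (λ x → trans (+-identityʳ _) (+-identityʳ _)) ⟩
  ∑ (allFin n) (occurrences F)                       ≡⟨ ∑-occurrences F ⟩
  length F                                           ≡⟨ lemma (length F) ⟩
  1 * length F * 1                                   ∎
  where
  open ≡-Reasoning
  lemma : ∀ a → a ≡ 1 * a * 1
  lemma = solve-∀
∑-hits {n} F (suc d) = begin
  ∑ (tuples n (suc (suc d))) (hits F)
    ≡⟨ ∑-tuples n (suc d) (hits F) ⟩
  ∑ (allFin n) (λ x → ∑ (tuples n (suc d)) (λ y → occurrences F x + hits F y))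
    ≡⟨ ∑-cong (allFin n) (λ x → trans (∑-+ (tuples n (suc d)) _ _) (cong₂ _+_ (∑-const-tuples n (suc d) _) (∑-hits F d))) ⟩
  ∑ (allFin n) (λ x → n ^ suc d * occurrences F x + suc d * length F * n ^ d)
    ≡⟨ ∑-+ (allFin n) _ _ ⟩
  ∑ (allFin n) (λ x → n ^ suc d * occurrences F x) + ∑ (allFin n) (λ _ → suc d * length F * n ^ d)
    ≡⟨ cong₂ _+_ (trans (∑-* (allFin n) (n ^ suc d) _) (cong (n ^ suc d *_) (∑-occurrences F))) (∑-const-allFin n _) ⟩
  n * n ^ d * length F + n * (suc d * length F * n ^ d)
    ≡⟨ lemma n (n ^ d) (length F) d ⟩
  suc (suc d) * length F * (n * n ^ d) ∎
  where
  open ≡-Reasoning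
  lemma : ∀ n p f d → n * p * f + n * (suc d * f * p) ≡ suc (suc d) * f * (n * p)
  lemma = solve-∀

ι-pos : ∀ {a b} → a < ι b → a ≡ 0 × b ≡ true
ι-pos {zero} {true} lt = refl , refl
ι-pos {suc a} {true} (s≤s ())

length-concatMap-toList : ∀ (y : A → Vec B d) xs → length (concatMap (toList ∘ y) xs) ≡ length xs * d
length-concatMap-toList y []       = refl
length-concatMap-toList y (x ∷ xs) = trans (length-++ (toList (y x))) (cong₂ _+_ (length-toList (y x))
  (length-concatMap-toList y xs))

-- Greedy choice of colours and of disjoint tuples

module _ {P : Set} (_≟ᴾ_ : DecidableEquality P) where

  _[_↦_] : (P → B) → P → B → P → B
  (f [ p ↦ b ]) q = if does (q ≟ᴾ p) then b else f q

  -- Since fewer than u of the u objects have fewer than u admissible colours, some object can be coloured last.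
  colouring : Fin k → (R : Fin k → P → Bool) (ps : List P) →
    (∀ j → 0 < j → ∑[ p ∈ ps ] ι ((∑[ i ∈ allFin k ] ι (R i p)) <ᵇ j) < j) →
    Σ (P → Fin k) λ c → (∀ {p} → p ∈ ps → R (c p) p ≡ true) ×
                        (∀ {p q} → p ∈ ps → q ∈ ps → c p ≡ c q → p ≡ q)
  colouring {k} i₀ R ps = go (length ps) ps refl
    where
    count : P → ℕ
    count p = ∑[ i ∈ allFin k ] ι (R i p)

    Colouring : List P → Set
    Colouring ps = Σ (P → Fin k) λ c → (∀ {p} → p ∈ ps → R (c p) p ≡ true) ×
                                       (∀ {p q} → p ∈ ps → q ∈ ps → c p ≡ c q → p ≡ q)

    extend : ∀ p as bs → length (as ++ bs) < count p → Colouring (as ++ bs) → Colouring (as ++ p ∷ bs)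
    extend p as bs long (c , c-ok , c-inj)
      -- The other objects use up fewer colours than `p` admits, so some admissible colour occurs
      -- nowhere among them.
      with i , _ , lt ← ∑-<⇒∃ (allFin k) (occurrences (map c (as ++ bs))) (λ i → ι (R i p))
             (≤-<-trans (≤-reflexive (trans (∑-occurrences (map c (as ++ bs))) (length-map c (as ++ bs)))) long)
         = c [ p ↦ i ] , ok , inj
      where
      old : ∀ {q} → q ∈ as ++ p ∷ bs → q ≢ p → q ∈ as ++ bs
      old q∈ q≢p with ∈-++⁻ as q∈
      ... | inj₁ q∈as         = ∈-++⁺ˡ q∈as
      ... | inj₂ (here q≡p)   = ⊥-elim (q≢p q≡p)
      ... | inj₂ (there q∈bs) = ∈-++⁺ʳ as q∈bs
      fresh : ∀ {q} → q ∈ as ++ p ∷ bs → q ≢ p → c q ≢ i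
      fresh q∈ q≢p cq≡i = occurrences≡0⇒∉ (map c (as ++ bs)) (proj₁ (ι-pos lt))
                            (subst (_∈ map c (as ++ bs)) cq≡i (∈-map⁺ c (old q∈ q≢p)))
      ok : ∀ {q} → q ∈ as ++ p ∷ bs → R ((c [ p ↦ i ]) q) q ≡ true
      ok {q} q∈ with q ≟ᴾ p
      ... | yes refl = proj₂ (ι-pos lt)
      ... | no q≢p   = c-ok (old q∈ q≢p)
      inj : ∀ {q q′} → q ∈ as ++ p ∷ bs → q′ ∈ as ++ p ∷ bs → (c [ p ↦ i ]) q ≡ (c [ p ↦ i ]) q′ → q ≡ q′
      inj {q} {q′} q∈ q′∈ eq with q ≟ᴾ p | q′ ≟ᴾ p
      ... | yes refl | yes refl = refl
      ... | yes refl | no q′≢p  = ⊥-elim (fresh q′∈ q′≢p (sym eq))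
      ... | no q≢p   | yes refl = ⊥-elim (fresh q∈ q≢p eq)
      ... | no q≢p   | no q′≢p  = c-inj (old q∈ q≢p) (old q′∈ q′≢p) eq

    go : ∀ u ps → length ps ≡ u → (∀ j → 0 < j → ∑[ p ∈ ps ] ι (count p <ᵇ j) < j) → Colouring ps
    -- `i₀` is the default colour for objects outside the list.
    go _       []         _   _     = (λ _ → i₀) , (λ ()) , λ ()
    go (suc u) ps@(_ ∷ _) len light
      -- The hypothesis with `j` equal to the number of objects leaves one object with at least that
      -- many colours.
      with ∑-<⇒∃ ps (λ p → ι (count p <ᵇ suc u)) (λ _ → 1)
             (<-≤-trans (light (suc u) z<s) (≤-reflexive (sym (trans (∑-const ps 1) (trans (*-identityʳ _) len)))))
    ... | p , p∈ , heavy with ∈-∃++ p∈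
    ...   | as , bs , ps≡ = subst Colouring (sym ps≡)
              (extend p as bs (≤-trans (s≤s (≤-reflexive len′)) u<count) (go u (as ++ bs) len′ light′))
      where
      len′ : length (as ++ bs) ≡ u
      len′ = suc-injective (begin
        suc (length (as ++ bs))        ≡⟨ cong suc (length-++ as) ⟩
        suc (length as + length bs)    ≡⟨ +-suc (length as) (length bs) ⟨
        length as + suc (length bs)    ≡⟨ length-++ as ⟨
        length (as ++ p ∷ bs)          ≡⟨ cong length ps≡ ⟨
        length ps                      ≡⟨ len ⟩
        suc u                          ∎)
        where open ≡-Reasoning
      light′ : ∀ j → 0 < j → ∑[ p ∈ as ++ bs ] ι (count p <ᵇ j) < j
      light′ j 0<j = begin-strict
        ∑ (as ++ bs) f              ≡⟨ ∑-++ as bs f ⟩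
        ∑ as f + ∑ bs f             ≤⟨ +-monoʳ-≤ (∑ as f) (m≤n+m (∑ bs f) (f p)) ⟩
        ∑ as f + ∑ (p ∷ bs) f       ≡⟨ ∑-++ as (p ∷ bs) f ⟨
        ∑ (as ++ p ∷ bs) f          ≡⟨ cong (λ z → ∑ z f) ps≡ ⟨
        ∑ ps f                      <⟨ light j 0<j ⟩
        j                           ∎
        where
        open ≤-Reasoning
        f : P → ℕ
        f p = ι (count p <ᵇ j)
      u<count : u < count p
      u<count with count p <ᵇ suc u in eq
      ... | false = ≮⇒≥ λ lt → subst T eq (<⇒<ᵇ lt)
      ... | true  = ⊥-elim (<-irrefl refl heavy)

  -- Tuples are chosen one object at a time, each avoiding the core and all tuples chosen so far.
  -- Together these have at most `f` vertices, as `avoid` demands; `y₀` is a default outside the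
  -- list.
  disjointTuples : Vec (Fin n) d → (Q : P → Vec (Fin n) d → Set) (f : ℕ) (core : List (Fin n)) (ps : List P) →
    length core + length ps * d ≤ f →
    (∀ {p} → p ∈ ps → ∀ F → length F ≤ f → Σ (Vec (Fin n) d) λ y → Q p y × (∀ j → lookupᵛ y j ∉ F)) →
    Σ (P → Vec (Fin n) d) λ y →
      (∀ {p} → p ∈ ps → Q p (y p)) ×
      (∀ {p} → p ∈ ps → ∀ j → lookupᵛ (y p) j ∉ core) ×
      (∀ {p q} → p ∈ ps → q ∈ ps → p ≢ q → ∀ j j′ → lookupᵛ (y p) j ≢ lookupᵛ (y q) j′)
  disjointTuples y₀ Q f core []       _   _ = (λ _ → y₀) , (λ ()) , (λ ()) , λ ()
  disjointTuples {n = n} {d} y₀ Q f core (p ∷ ps) len avoid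
    with y , y-ok , y-core , y-disj ← disjointTuples y₀ Q f core ps
           (≤-trans (+-monoʳ-≤ (length core) (m≤n+m _ d)) len) (avoid ∘ there)
    with z , z-ok , z-avoid ← avoid (here refl) (core ++ concatMap (toList ∘ y) ps)
           (≤-trans (≤-reflexive (trans (length-++ core) (cong (length core +_) (length-concatMap-toList y ps))))
                    (≤-trans (+-monoʳ-≤ (length core) (m≤n+m _ d)) len))
       = y [ p ↦ z ] , ok , ok-core , disj
    where
    old : ∀ {q} → q ∈ p ∷ ps → q ≢ p → q ∈ ps
    old (here q≡p) q≢p = ⊥-elim (q≢p q≡p)
    old (there q∈) _   = q∈
    fresh : ∀ {q} → q ∈ ps → ∀ j j′ → lookupᵛ z j ≢ lookupᵛ (y q) j′
    fresh {q} q∈ j j′ eq = z-avoid j (∈-++⁺ʳ core (∈-concatMap⁺ (toList ∘ y)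
      (lose q∈ (subst (_∈ toList (y q)) (sym eq) (∈-toList⁺ (∈ᵛ-lookup j′ (y q)))))))
    ok : ∀ {q} → q ∈ p ∷ ps → Q q ((y [ p ↦ z ]) q)
    ok {q} q∈ with q ≟ᴾ p
    ... | yes refl = z-ok
    ... | no q≢p   = y-ok (old q∈ q≢p)
    ok-core : ∀ {q} → q ∈ p ∷ ps → ∀ j → lookupᵛ ((y [ p ↦ z ]) q) j ∉ core
    ok-core {q} q∈ j with q ≟ᴾ p
    ... | yes refl = z-avoid j ∘ ∈-++⁺ˡ
    ... | no q≢p   = y-core (old q∈ q≢p) j
    disj : ∀ {q q′} → q ∈ p ∷ ps → q′ ∈ p ∷ ps → q ≢ q′ →
           ∀ j j′ → lookupᵛ ((y [ p ↦ z ]) q) j ≢ lookupᵛ ((y [ p ↦ z ]) q′) j′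
    disj {q} {q′} q∈ q′∈ q≢q′ j j′ with q ≟ᴾ p | q′ ≟ᴾ p
    ... | yes refl | yes refl = ⊥-elim (q≢q′ refl)
    ... | yes refl | no q′≢p  = fresh (old q′∈ q′≢p) j j′
    ... | no q≢p   | yes refl = fresh (old q∈ q≢p) j′ j ∘ sym
    ... | no q≢p   | no q′≢p  = y-disj (old q∈ q≢p) (old q′∈ q′≢p) q≢q′ j j′

_≟ᴾ_ : ∀ {ℓ} → DecidableEquality (Pair ℓ)
((a , b) , lt) ≟ᴾ ((a′ , b′) , lt′) with a ≟ᶠ a′ | b ≟ᶠ b′
... | yes refl | yes refl = yes (cong (_ ,_) (≤-irrelevant lt lt′))
... | yes _    | no b≢b′  = no λ { refl → b≢b′ refl }
... | no a≢a′  | _        = no λ { refl → a≢a′ refl }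

-- Ordered edges and codegrees

-- With distinctness built in, an ordered edge yields an injective tuple (`distinct-injective`), and
-- the codegree of a vertex with itself vanishes (`codegree-diagonal`).
orderedEdge : Hypergraph n → Vec (Fin n) d → Bool
orderedEdge H y = distinct y ∧B H (verts y)

-- Counts ordered completions: for `a ≢ b` and a `(2 + d)`-uniform `H` it is `d !` times the usual
-- codegree.
codegree : ∀ d → Hypergraph n → Fin n → Fin n → ℕ
codegree {n} d H a b = ∑[ y ∈ tuples n d ] ι (orderedEdge H (a ∷ b ∷ y))

lookup-verts : ∀ (y : Vec (Fin n) d) j → lookupᵛ (verts y) (lookupᵛ y j) ≡ true
lookup-verts (x ∷ y) zero    = lookup∘update x (verts y) true
lookup-verts (x ∷ y) (suc j) with lookupᵛ y j ≟ᶠ x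
... | yes refl = lookup∘update x (verts y) true
... | no ≢x    = trans (lookup∘update′ ≢x (verts y) true) (lookup-verts y j)

distinct-injective : ∀ (y : Vec (Fin n) d) → distinct y ≡ true → Injective _≡_ _≡_ (lookupᵛ y)
distinct-injective (x ∷ y) D {zero}  {zero}  eq = refl
distinct-injective (x ∷ y) D {suc i} {suc j} eq = cong suc (distinct-injective y (∧-conicalʳ _ _ D) eq)
distinct-injective (x ∷ y) D {zero}  {suc j} refl with lookupᵛ (verts y) (lookupᵛ y j) | lookup-verts y j
... | true | refl with () ← D
distinct-injective (x ∷ y) D {suc i} {zero}  refl with lookupᵛ (verts y) (lookupᵛ y i) | lookup-verts y i
... | true | refl with () ← D

orderedEdge-distinct : ∀ (H : Hypergraph n) a b (y : Vec (Fin n) d) → orderedEdge H (a ∷ b ∷ y) ≡ true → distinct y ≡ true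
orderedEdge-distinct H a b y eq =
  ∧-conicalʳ (not (lookupᵛ (verts y) b)) (distinct y)
    (∧-conicalʳ (not (lookupᵛ (verts (b ∷ y)) a)) (distinct (b ∷ y))
      (∧-conicalˡ (distinct (a ∷ b ∷ y)) (H (verts (a ∷ b ∷ y))) eq))

codegree-diagonal : ∀ d (H : Hypergraph n) a → codegree d H a a ≡ 0
codegree-diagonal {n} d H a = trans (∑-cong (tuples n d) (λ y → cong (λ b → ι
  ((not b ∧B distinct (a ∷ y)) ∧B H (verts (a ∷ a ∷ y)))) (lookup∘update a (verts y) true)))
  (trans (∑-const-tuples n d 0) (*-zeroʳ (n ^ d)))

insert-∪ : ∀ (x : Fin n) s → ⁅ x ⁆ ∪ s ≡ s [ x ]≔ true
insert-∪ zero    (b ∷ s) = cong (true ∷_) (∪-identityˡ s)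
insert-∪ (suc x) (b ∷ s) = cong (b ∷_) (insert-∪ x s)

⋃-verts : ∀ (y : Vec (Fin n) d) → ⋃ (map (λ j → ⁅ lookupᵛ y j ⁆) (allFin d)) ≡ verts y
⋃-verts []      = refl
⋃-verts {d = suc d} (x ∷ y) = trans (cong (⁅ x ⁆ ∪_) (trans (cong ⋃ (trans (map-tabulate suc _)
  (sym (map-tabulate {n = d} (λ i → i) _)))) (⋃-verts y)))
  (insert-∪ x (verts y))

-- Rich pairs and the rainbow expansion

module _ (ρ B : ℕ) {n k : ℕ} (H : Fin k → Hypergraph n) where

  -- A rich pair lies in edges of colour i avoiding any prescribed bounded set of vertices, once B is large.
  rich : Fin k → Fin n → Fin n → Bool
  rich i a b = B * n ^ ρ <ᵇ codegree (suc ρ) (H i) a b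

  multiplicity : Fin n → Fin n → ℕ
  multiplicity a b = ∑[ i ∈ allFin k ] ι (rich i a b)

  multiplicity-diagonal : ∀ a → multiplicity a a ≡ 0
  multiplicity-diagonal a = trans (∑-cong (allFin k) (λ i → cong (λ c → ι (B * n ^ ρ <ᵇ c))
    (codegree-diagonal (suc ρ) (H i) a)))
    (trans (∑-const-allFin k 0) (*-zeroʳ k))

  module _ (f : ℕ) (B≥ : suc ρ * f ≤ B) where

    -- By `∑-hits` the completions meeting `F`, counted with multiplicity, number at most
    -- `(ρ + 1) f n^ρ ≤ B n^ρ`, and a rich pair has more completions than that.
    rich-avoid : ∀ i a b → rich i a b ≡ true → ∀ F → length F ≤ f →
      Σ (Vec (Fin n) (suc ρ)) λ y → (orderedEdge (H i) (a ∷ b ∷ y) ≡ true) × (∀ j → lookupᵛ y j ∉ F)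
    rich-avoid i a b r F len
      with y , _ , lt ← ∑-<⇒∃ (tuples n (suc ρ)) (hits F) (λ y → ι (orderedEdge (H i) (a ∷ b ∷ y)))
             (≤-<-trans (≤-trans (≤-reflexive (∑-hits F ρ)) (*-monoˡ-≤ (n ^ ρ) (≤-trans (*-monoʳ-≤ (suc ρ) len) B≥)))
               (<ᵇ-true r))
         = y , proj₂ (ι-pos lt) , hits≡0⇒∉ F y (proj₁ (ι-pos lt))

    -- First the core pairs receive distinct colours in which they are rich, then each pair a
    -- completion disjoint from the core and from the others. The number `f` bounds all vertices of
    -- the expansion.
    rainbow : Fin k → ∀ xs → 0 < length xs → length xs + (length xs C 2) * suc ρ ≤ f →
      (∀ j → 0 < j → lightPairs multiplicity j xs < j) → RainbowExpansion (length xs) (3 + ρ) H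
    rainbow i₀ xs@(x₀ ∷ _) _ len light
      with c , c-ok , c-inj ← colouring _≟ᴾ_ i₀ (λ i ((a , b) , _) → rich i (lookup xs a) (lookup xs b))
        (pairs (length xs)) light
      with y , y-ok , y-core , y-disj ← disjointTuples _≟ᴾ_ (replicate (suc ρ) x₀)
             (λ p@((a , b) , _) y → orderedEdge (H (c p)) (lookup xs a ∷ lookup xs b ∷ y) ≡ true)
             f xs (pairs (length xs))
             (≤-trans (≤-reflexive (cong (λ z → length xs + z * suc ρ) (length-pairs (length xs)))) len)
             (λ {p@((a , b) , _)} p∈ → rich-avoid (c p) (lookup xs a) (lookup xs b) (c-ok p∈))
         = φ , φ-inj , c , (λ {p} {q} → c-inj (∈-pairs p) (∈-pairs q)) , edge
      where
      ℓ = length xs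
      φ : ExpVertex ℓ (3 + ρ) → Fin n
      φ (inj₁ a)       = lookup xs a
      φ (inj₂ (p , j)) = lookupᵛ (y p) j
      -- The case `j = 1` of `light` says that no pair has multiplicity zero, whereas a repeated
      -- vertex would give one.
      apart : ∀ {a b} → a <ᶠ b → lookup xs a ≢ lookup xs b
      apart {a} {b} a<b eq = <⇒≱ (light 1 z<s) (≤-trans (≤-reflexive (sym one)) (∑-∈ (∈-pairs ((a , b) , a<b))))
        where
        one : ι (pairWeight multiplicity xs ((a , b) , a<b) <ᵇ 1) ≡ 1
        one = cong (λ z → ι (z <ᵇ 1)) (trans (cong (λ z → multiplicity z _) eq) (multiplicity-diagonal (lookup xs b)))
      φ-inj : Injective _≡_ _≡_ φ
      φ-inj {inj₁ a} {inj₁ b} eq with <ᶠ-cmp a b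
      ... | tri< a<b _ _ = ⊥-elim (apart a<b eq)
      ... | tri≈ _ a≡b _ = cong inj₁ a≡b
      ... | tri> _ _ b<a = ⊥-elim (apart b<a (sym eq))
      φ-inj {inj₁ a} {inj₂ (p , j)} eq = ⊥-elim (y-core (∈-pairs p) j (subst (_∈ xs) eq (∈-lookup a)))
      φ-inj {inj₂ (p , j)} {inj₁ a} eq = ⊥-elim (y-core (∈-pairs p) j (subst (_∈ xs) (sym eq) (∈-lookup a)))
      φ-inj {inj₂ (p , j)} {inj₂ (q , j′)} eq with p ≟ᴾ q
      ... | no p≢q   = ⊥-elim (y-disj (∈-pairs p) (∈-pairs q) p≢q j j′ eq)
      ... | yes refl = cong (λ z → inj₂ (p , z)) (distinct-injective (y p)
        (orderedEdge-distinct (H (c p)) _ _ (y p) (y-ok (∈-pairs p))) eq)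
      edge : ∀ p → H (c p) (edgeImage {n} {ℓ} {3 + ρ} φ p) ≡ true
      edge p@((a , b) , _) = trans (cong (H (c p)) (trans (cong (λ s → ⁅ lookup xs a ⁆ ∪ (⁅ lookup xs b ⁆ ∪ s))
        (⋃-verts (y p)))
        (trans (cong (⁅ lookup xs a ⁆ ∪_) (insert-∪ (lookup xs b) _)) (insert-∪ (lookup xs a) _))))
          (∧-conicalʳ _ _ (y-ok (∈-pairs p)))

-- Symmetry of ordered edges

verts-swap : ∀ a b (y : Vec (Fin n) d) → verts (a ∷ b ∷ y) ≡ verts (b ∷ a ∷ y)
verts-swap a b y with a ≟ᶠ b
... | yes refl = refl
... | no a≢b   = []≔-commutes (verts y) b a (a≢b ∘ sym)

distinct-swap : ∀ a b (y : Vec (Fin n) d) → distinct (a ∷ b ∷ y) ≡ distinct (b ∷ a ∷ y)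
distinct-swap a b y with a ≟ᶠ b
... | yes refl = refl
... | no a≢b rewrite lookup∘update′ a≢b (verts y) true | lookup∘update′ (a≢b ∘ sym) (verts y) true =
  ∧-swap (not (lookupᵛ (verts y) a)) (not (lookupᵛ (verts y) b)) (distinct y)
  where
  ∧-swap : ∀ u v w → u ∧B (v ∧B w) ≡ v ∧B (u ∧B w)
  ∧-swap true  v     w = refl
  ∧-swap false true  w = refl
  ∧-swap false false w = refl

orderedEdge-swap : ∀ (H : Hypergraph n) a b (y : Vec (Fin n) d) → orderedEdge H (a ∷ b ∷ y) ≡ orderedEdge H (b ∷ a ∷ y)
orderedEdge-swap H a b y = cong₂ (λ u s → u ∧B H s) (distinct-swap a b y) (verts-swap a b y)

-- Composed of two transpositions. Rotation replaces the leading pair `(a , b)` by `(b , c)` at the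
-- same edge, which takes a third vertex and so `r ≥ 3`.
orderedEdge-rotate : ∀ (H : Hypergraph n) a b c (y : Vec (Fin n) d) →
                     orderedEdge H (a ∷ b ∷ c ∷ y) ≡ orderedEdge H (b ∷ c ∷ a ∷ y)
orderedEdge-rotate H a b c y = trans (orderedEdge-swap H a b (c ∷ y))
  (cong₂ (λ u s → u ∧B H s)
    (cong₂ (λ s u → not (lookupᵛ s b) ∧B u) (verts-swap a c y) (distinct-swap a c y))
    (cong (_[ b ]≔ true) (verts-swap a c y)))

codegree-sym : ∀ d (H : Hypergraph n) a b → codegree d H a b ≡ codegree d H b a
codegree-sym {n} d H a b = ∑-cong (tuples n d) (λ y → cong ι (orderedEdge-swap H a b y))

-- Double counting, averaging and initial segments

∑-rotate : ∀ (xs : List A) (ys : List B) (zs : List X) (F : A → B → X → ℕ) →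
           ∑[ x ∈ xs ] (∑[ y ∈ ys ] (∑[ z ∈ zs ] F x y z)) ≡ ∑[ y ∈ ys ] (∑[ z ∈ zs ] (∑[ x ∈ xs ] F x y z))
∑-rotate xs ys zs F = trans (∑-comm xs ys _) (∑-cong ys (λ y → ∑-comm xs zs _))

∑-tuples₂ : ∀ n d (f : Vec (Fin n) (2 + d) → ℕ) →
            ∑ (tuples n (2 + d)) f ≡ ∑[ a ∈ allFin n ] (∑[ b ∈ allFin n ] (∑[ y ∈ tuples n d ] f (a ∷ b ∷ y)))
∑-tuples₂ n d f = trans (∑-tuples n (suc d) f) (∑-cong (allFin n) (λ a → ∑-tuples n d (λ y → f (a ∷ y))))

∑-∑-const : ∀ n c → ∑[ _ ∈ allFin n ] (∑[ _ ∈ allFin n ] c) ≡ n * (n * c)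
∑-∑-const n c = trans (∑-const-allFin n _) (cong (n *_) (∑-const-allFin n c))

average : ∀ n {c} (f : Fin n → ℕ) → 0 < n → ∑ (allFin n) f ≤ n * c → ∃ λ x → f x ≤ c
average n {c} f 0<n le with x , _ , lt ← ∑-<⇒∃ (allFin n) f (λ _ → suc c)
      (≤-<-trans le (<-≤-trans (*-monoʳ-< n {{>-nonZero 0<n}} (n<1+n c)) (≤-reflexive (sym (∑-const-allFin n (suc c)))))) =
  x , s≤s⁻¹ lt

-- `∑-distinct` applied to the indicator of `H`; by uniformity the size restriction there is
-- automatic.
∑-orderedEdge : ∀ r (H : Hypergraph n) → Uniform r H → ∑[ x ∈ tuples n r ] ι (orderedEdge H x) ≡ r ! * e H
∑-orderedEdge {n} r H unif = begin
  ∑[ x ∈ tuples n r ] ι (orderedEdge H x)             ≡⟨ ∑-cong (tuples n r) (λ x → ι-∧ (distinct x) (H (verts x))) ⟩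
  ∑[ x ∈ tuples n r ] ι (distinct x) * ι (H (verts x))  ≡⟨ ∑-distinct r (ι ∘ H) ⟩
  r ! * (∑[ s ∈ allSubsets n ] ι (sized r s) * ι (H s)) ≡⟨ cong (r ! *_) (∑-cong (allSubsets n) all-sized) ⟩
  r ! * (∑[ s ∈ allSubsets n ] ι (H s))                 ≡⟨ cong (r ! *_) (length-filterᵇ H (allSubsets n)) ⟨
  r ! * e H                                             ∎
  where
  open ≡-Reasoning
  all-sized : ∀ s → ι (sized r s) * ι (H s) ≡ ι (H s)
  all-sized s with H s in eq
  ... | false = *-zeroʳ (ι (sized r s))
  ... | true  rewrite unif s eq = cong (λ b → ι b * 1) (dec-true (r ≟ r) refl)

-- The error is a signed difference plus twice a one-sided error, written without subtraction.
-- Signed differences will be controlled by total counts, so only edges over pairs that are not rich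
-- need a direct bound.
xor-excess : ∀ u v → ι (u xor v) + ι u ≡ ι v + 2 * ι (u ∧B not v)
xor-excess true  true  = refl
xor-excess true  false = refl
xor-excess false true  = refl
xor-excess false false = refl

≤-xor : ∀ u v → ι v ≤ ι u + ι (u xor v)
≤-xor true  v     = ≤-trans (ι≤1 v) (m≤m+n 1 _)
≤-xor false v     = ≤-refl

-- If `zero` fails, closure makes every index fail and `m` is zero; otherwise the successors are
-- treated with `m` lowered by one.
downset-prefix : ∀ {k} m (P : Fin k → Bool) → (∀ {i j} → i ≤ᶠ j → P j ≡ true → P i ≡ true) →
                 ∑[ i ∈ allFin k ] ι (P i) ≡ m → ∀ i → P i ≡ (toℕ i <ᵇ m)
downset-prefix {suc k} m P down eq i with P zero in P₀ | trans (sym (∑-allFin k (ι ∘ P))) eq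
downset-prefix {suc k} (suc m) P down eq zero    | true | eq′ = P₀
downset-prefix {suc k} (suc m) P down eq (suc i) | true | eq′ =
  downset-prefix m (P ∘ suc) (λ i≤j → down (s≤s i≤j)) (suc-injective eq′) i
downset-prefix {suc k} m P down eq i | false | eq′ = trans (none i) (cong (toℕ i <ᵇ_) (sym m≡0))
  where
  none : ∀ i → P i ≡ false
  none i with P i in Pi
  ... | false = refl
  ... | true with () ← trans (sym P₀) (down z≤n Pi)
  m≡0 : m ≡ 0
  m≡0 = trans (sym eq) (trans (∑-cong (allFin (suc k)) (λ i → cong ι (none i)))
    (trans (∑-const-allFin (suc k) 0) (*-zeroʳ (suc k))))

anyB-∑ : ∀ {k} (f : Fin k → Bool) → ι (anyB f) ≤ ∑[ i ∈ allFin k ] ι (f i)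
anyB-∑ {zero}  f = z≤n
anyB-∑ {suc k} f = ≤-trans step (≤-reflexive (sym (∑-allFin k (ι ∘ f))))
  where
  step : ι (anyB f) ≤ ι (f zero) + ∑ (allFin k) (ι ∘ f ∘ suc)
  step with f zero
  ... | true  = s≤s z≤n
  ... | false = anyB-∑ (f ∘ suc)

anyB-∃ : ∀ {k} (f : Fin k → Bool) → anyB f ≡ true → ∃ λ i → f i ≡ true
anyB-∃ {suc k} f eq with f zero in f₀
... | true  = zero , f₀
... | false with i , fi ← anyB-∃ (f ∘ suc) eq = suc i , fi

anyB-∀ : ∀ {k} (f : Fin k → Bool) → anyB f ≡ false → ∀ i → f i ≡ false
anyB-∀ {suc k} f eq i with f zero in f₀
anyB-∀ {suc k} f eq zero    | false = f₀
anyB-∀ {suc k} f eq (suc i) | false = anyB-∀ (f ∘ suc) eq i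

xor-false : ∀ {u v} → (u xor v) ≡ false → u ≡ v
xor-false {true}  {true}  _ = refl
xor-false {false} {false} _ = refl

-- Stability of the colour classes

module _ (ρ B m ℓ c : ℕ) {n k : ℕ} (H : Fin k → Hypergraph n) (0<n : 0 < n)
         (F : ℕ) (F≡ : F ≡ (3 + ρ) !)
         (uniform : ∀ i → Uniform (3 + ρ) (H i))
         (weight≤ : weight (multiplicity ρ B H) (allFin n) (allFin n) ≤ m * (n * n) + k * ℓ * n)
         (total≥ : m * (n C (3 + ρ)) ≤ totalEdges H + c * n ^ (2 + ρ)) where

  private
    r Q K L E : ℕ
    r = 3 + ρ
    Q = n ^ (2 + ρ)
    -- Errors are measured in units of `Q = n^(r-1)`. `K` is the error in `mismatch+edges`, from the
    -- weight bound and from codegrees not above the richness threshold; `L` is the error in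
    -- `edges-lower`, from the deficit `c` and from `n^r` against `r ! C(n, r)`.
    K = k * ℓ + k * (2 * B)
    L = F * c + m * (r * r)
    E = K + L
    V = allFin n
    g : Fin k → Fin n → Fin n → Bool
    g = rich ρ B H
    h : Fin k → Vec (Fin n) r → Bool
    h i = orderedEdge (H i)

  instance
    n^ρ≢0 : NonZero (n ^ ρ)
    n^ρ≢0 = m^n≢0 n ρ {{>-nonZero 0<n}}
    Q≢0 : NonZero Q
    Q≢0 = m^n≢0 n (2 + ρ) {{>-nonZero 0<n}}

  edges : Fin k → ℕ
  edges i = ∑[ x ∈ tuples n r ] ι (h i x)

  edges≡ : ∀ i → edges i ≡ F * e (H i)
  edges≡ i = trans (∑-orderedEdge r (H i) (uniform i)) (cong (_* e (H i)) (sym F≡))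

  ∑-edges : ∑ (allFin k) edges ≡ F * totalEdges H
  ∑-edges = trans (∑-cong (allFin k) edges≡) (∑-* (allFin k) (F) (e ∘ H))

  mismatch : Fin k → ℕ
  mismatch i = ∑[ a ∈ V ] (∑[ b ∈ V ] (∑[ y ∈ tuples n (suc ρ) ] ι (h i (a ∷ b ∷ y) xor g i a b)))

  -- `xor-excess` summed over completions. Its one-sided term counts edges on a pair that is not
  -- rich, of which there are at most `B * n ^ ρ` by the definition of `rich`.
  mismatch-pair : ∀ i a b →
    (∑[ y ∈ tuples n (suc ρ) ] ι (h i (a ∷ b ∷ y) xor g i a b)) + codegree (suc ρ) (H i) a b ≤
    n ^ suc ρ * ι (g i a b) + 2 * (B * n ^ ρ)
  mismatch-pair i a b = begin
    (∑[ y ∈ Y ] ι (h i (a ∷ b ∷ y) xor g i a b)) + codegree (suc ρ) (H i) a b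
      ≡⟨ ∑-+ Y _ _ ⟨
    ∑[ y ∈ Y ] (ι (h i (a ∷ b ∷ y) xor g i a b) + ι (h i (a ∷ b ∷ y)))
      ≡⟨ ∑-cong Y (λ y → xor-excess (h i (a ∷ b ∷ y)) (g i a b)) ⟩
    ∑[ y ∈ Y ] (ι (g i a b) + 2 * ι (h i (a ∷ b ∷ y) ∧B not (g i a b)))
      ≡⟨ trans (∑-+ Y _ _) (cong₂ _+_ (∑-const-tuples n (suc ρ) _) (∑-* Y 2 _)) ⟩
    n ^ suc ρ * ι (g i a b) + 2 * (∑[ y ∈ Y ] ι (h i (a ∷ b ∷ y) ∧B not (g i a b)))
      ≤⟨ +-monoʳ-≤ (n ^ suc ρ * ι (g i a b)) (*-monoʳ-≤ 2 low) ⟩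
    n ^ suc ρ * ι (g i a b) + 2 * (B * n ^ ρ) ∎
    where
    open ≤-Reasoning
    Y = tuples n (suc ρ)
    low : ∑[ y ∈ Y ] ι (h i (a ∷ b ∷ y) ∧B not (g i a b)) ≤ B * n ^ ρ
    low with g i a b in eq
    ... | true  = ≤-trans (≤-reflexive (trans (∑-cong Y (λ y → cong ι (∧-zeroʳ (h i (a ∷ b ∷ y)))))
      (trans (∑-const-tuples n (suc ρ) 0) (*-zeroʳ (n ^ suc ρ))))) z≤n
    ... | false = ≤-trans (≤-reflexive (∑-cong Y (λ y → cong ι (∧-identityʳ (h i (a ∷ b ∷ y))))))
      (≮⇒≥ λ lt → subst T eq (<⇒<ᵇ lt))

  -- Summing over the colours first turns richness into `multiplicity`, whose total over ordered
  -- pairs is bounded by `weight≤`.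
  mismatch+edges : ∑ (allFin k) mismatch + F * totalEdges H ≤ m * (n * Q) + (k * ℓ + k * (2 * B)) * Q
  mismatch+edges = begin
    ∑ (allFin k) mismatch + F * totalEdges H
      ≡⟨ cong (∑ (allFin k) mismatch +_) ∑-edges ⟨
    ∑ (allFin k) mismatch + ∑ (allFin k) edges
      ≡⟨ ∑-+ (allFin k) _ _ ⟨
    ∑[ i ∈ allFin k ] (mismatch i + edges i)
      ≡⟨ ∑-cong (allFin k) (λ i → trans (cong (mismatch i +_) (∑-tuples₂ n (suc ρ) _))
        (sym (trans (∑-cong V (λ a → ∑-+ V _ _)) (∑-+ V _ _)))) ⟩
    ∑[ i ∈ allFin k ] (∑[ a ∈ V ] (∑[ b ∈ V ] ((∑[ y ∈ tuples n (suc ρ) ] ι (h i (a ∷ b ∷ y) xor g i a b)) + codegree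
      (suc ρ) (H i) a b)))
      ≤⟨ ∑-mono (allFin k) (λ i → ∑-mono V (λ a → ∑-mono V (λ b → mismatch-pair i a b))) ⟩
    ∑[ i ∈ allFin k ] (∑[ a ∈ V ] (∑[ b ∈ V ] (n ^ suc ρ * ι (g i a b) + low)))
      ≡⟨ ∑-rotate (allFin k) V V _ ⟩
    ∑[ a ∈ V ] (∑[ b ∈ V ] (∑[ i ∈ allFin k ] (n ^ suc ρ * ι (g i a b) + low)))
      ≡⟨ ∑-cong V (λ a → ∑-cong V (λ b → trans (∑-+ (allFin k) _ _) (cong₂ _+_ (∑-* (allFin k) (n ^ suc ρ) _)
        (∑-const-allFin k low)))) ⟩
    ∑[ a ∈ V ] (∑[ b ∈ V ] (n ^ suc ρ * multiplicity ρ B H a b + k * low))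
      ≡⟨ trans (∑-cong V (λ a → trans (∑-+ V _ _) (cong₂ _+_ (∑-* V (n ^ suc ρ) _) refl)))
        (trans (∑-+ V _ _) (cong₂ _+_ (∑-* V (n ^ suc ρ) _) (∑-∑-const n (k * low)))) ⟩
    n ^ suc ρ * weight (multiplicity ρ B H) V V + n * (n * (k * low))
      ≤⟨ +-monoˡ-≤ _ (*-monoʳ-≤ (n ^ suc ρ) weight≤) ⟩
    n ^ suc ρ * (m * (n * n) + k * ℓ * n) + n * (n * (k * low))
      ≡⟨ arith n (n ^ ρ) m k ℓ B ⟩
    m * (n * Q) + (k * ℓ + k * (2 * B)) * Q ∎
    where
    open ≤-Reasoning
    low = 2 * (B * n ^ ρ)
    arith : ∀ n T m k ℓ B → n * T * (m * (n * n) + k * ℓ * n) + n * (n * (k * (2 * (B * T)))) ≡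
                            m * (n * (n * (n * T))) + (k * ℓ + k * (2 * B)) * (n * (n * T))
    arith = solve-∀

  edges-lower : m * (n * Q) ≤ F * totalEdges H + (F * c + m * (r * r)) * Q
  edges-lower = begin
    m * (n * Q)                                       ≤⟨ *-monoʳ-≤ m (subst (λ z → n * Q ≤ z * (n C r) + r * r * Q)
      (sym F≡) (n^k≤k!nCk n (2 + ρ))) ⟩
    m * (F * (n C r) + r * r * Q)                   ≡⟨ arith₁ m (F) (n C r) (r * r) Q ⟩
    F * (m * (n C r)) + m * (r * r) * Q             ≤⟨ +-monoˡ-≤ _ (*-monoʳ-≤ (F) total≥) ⟩
    F * (totalEdges H + c * Q) + m * (r * r) * Q    ≡⟨ arith₂ (F) (totalEdges H) c Q (m * (r * r)) ⟩
    F * totalEdges H + (F * c + m * (r * r)) * Q  ∎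
    where
    open ≤-Reasoning
    arith₁ : ∀ m f b s Q → m * (f * b + s * Q) ≡ f * (m * b) + m * s * Q
    arith₁ = solve-∀
    arith₂ : ∀ f t c Q s → f * (t + c * Q) + s * Q ≡ f * t + (f * c + s) * Q
    arith₂ = solve-∀

  -- The number of edges cancels between `mismatch+edges` and `edges-lower`, and so does the main
  -- term `m * (n * Q)`.
  mismatch-bound : ∑ (allFin k) mismatch ≤ E * Q
  mismatch-bound = +-cancelʳ-≤ (F * totalEdges H) _ _ (begin
    ∑ (allFin k) mismatch + F * totalEdges H                 ≤⟨ mismatch+edges ⟩
    m * (n * Q) + K * Q                                        ≤⟨ +-monoˡ-≤ _ edges-lower ⟩
    F * totalEdges H + L * Q + K * Q                         ≡⟨ arith (F * totalEdges H) L K Q ⟩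
    (K + L) * Q + F * totalEdges H                           ∎)
    where
    open ≤-Reasoning
    arith : ∀ t L K Q → t + L * Q + K * Q ≡ (K + L) * Q + t
    arith = solve-∀

  turn : Fin k → Fin n → Fin n → Fin n → ℕ
  turn i a b c = ι (g i a b xor g i b c)

  turns : ℕ
  turns = ∑[ i ∈ allFin k ] (∑[ a ∈ V ] (∑[ b ∈ V ] (∑[ c ∈ V ] turn i a b c)))

  -- Both g(a,b) and g(b,c) are compared with the edge value at (a,b,c,z), which is invariant under rotation.
  turns-bound : turns ≤ 2 * E * (n * n)
  turns-bound = *-cancelˡ-≤ (n ^ ρ) (begin
    n ^ ρ * turns
      ≡⟨ trans (sym (∑-* (allFin k) (n ^ ρ) _)) (∑-cong (allFin k) (λ i → trans (sym (∑-* V (n ^ ρ) _))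
        (∑-cong V (λ a → trans (sym (∑-* V (n ^ ρ) _)) (∑-cong V (λ b → sym (∑-* V (n ^ ρ) _))))))) ⟩
    ∑[ i ∈ allFin k ] (∑[ a ∈ V ] (∑[ b ∈ V ] (∑[ c ∈ V ] n ^ ρ * turn i a b c)))
      ≤⟨ ∑-mono (allFin k) (λ i → ∑-mono V (λ a → ∑-mono V (λ b → ∑-mono V (λ c → turn≤ i a b c)))) ⟩
    ∑[ i ∈ allFin k ] (∑[ a ∈ V ] (∑[ b ∈ V ] (∑[ c ∈ V ] (M i a b c + M i b c a))))
      ≡⟨ ∑-cong (allFin k) (λ i → trans (∑-cong V (λ a → trans (∑-cong V (λ b → ∑-+ V _ _)) (∑-+ V _ _))) (∑-+ V _ _)) ⟩
    ∑[ i ∈ allFin k ] (∑³ (M i) + ∑³ (λ a b c → M i b c a))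
      ≡⟨ ∑-cong (allFin k) (λ i → cong₂ _+_ (∑³M i) (trans (∑-rotate V V V (λ a b c → M i b c a)) (∑³M i))) ⟩
    ∑[ i ∈ allFin k ] (mismatch i + mismatch i)
      ≡⟨ ∑-+ (allFin k) _ _ ⟩
    ∑ (allFin k) mismatch + ∑ (allFin k) mismatch
      ≤⟨ +-mono-≤ mismatch-bound mismatch-bound ⟩
    E * Q + E * Q
      ≡⟨ arith E n (n ^ ρ) ⟩
    n ^ ρ * (2 * E * (n * n)) ∎)
    where
    open ≤-Reasoning
    arith : ∀ E n T → E * (n * (n * T)) + E * (n * (n * T)) ≡ T * (2 * E * (n * n))
    arith = solve-∀
    M : Fin k → Fin n → Fin n → Fin n → ℕ
    M i a b c = ∑[ z ∈ tuples n ρ ] ι (h i (a ∷ b ∷ c ∷ z) xor g i a b)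
    ∑³ : (Fin n → Fin n → Fin n → ℕ) → ℕ
    ∑³ F = ∑[ a ∈ V ] (∑[ b ∈ V ] (∑[ c ∈ V ] F a b c))
    ∑³M : ∀ i → ∑³ (M i) ≡ mismatch i
    ∑³M i = ∑-cong V (λ a → ∑-cong V (λ b → sym (∑-tuples n ρ (λ y → ι (h i (a ∷ b ∷ y) xor g i a b)))))
    turn≤ : ∀ i a b c → n ^ ρ * turn i a b c ≤ M i a b c + M i b c a
    turn≤ i a b c = begin
      n ^ ρ * turn i a b c                    ≡⟨ ∑-const-tuples n ρ _ ⟨
      ∑[ _ ∈ tuples n ρ ] turn i a b c        ≤⟨ ∑-mono (tuples n ρ) pointwise ⟩
      ∑[ z ∈ tuples n ρ ] (ι (h i (a ∷ b ∷ c ∷ z) xor g i a b) + ι (h i (b ∷ c ∷ a ∷ z) xor g i b c)) ≡⟨ ∑-+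
        (tuples n ρ) _ _ ⟩
      M i a b c + M i b c a                   ∎
      where
      pointwise : ∀ z → turn i a b c ≤ ι (h i (a ∷ b ∷ c ∷ z) xor g i a b) + ι (h i (b ∷ c ∷ a ∷ z) xor g i b c)
      pointwise z = ≤-trans (xor-triangle (g i a b) (h i (a ∷ b ∷ c ∷ z)) (g i b c))
        (≤-reflexive (cong₂ _+_ (cong ι (xor-comm (g i a b) _)) (cong (λ u → ι (u xor g i b c))
          (orderedEdge-rotate (H i) a b c z))))

  -- `P i` chooses whether colour `i` is compared with all tuples or with none. Tuples with repeated
  -- entries count as errors when `P i` holds.
  deviation : (Fin k → Bool) → Fin k → ℕ
  deviation P i = ∑[ x ∈ tuples n r ] ι (h i x xor P i)

  -- Chaining two turns from (x₁,x₂) through (x₂,u) to (u,v) compares an edge value with g(u,v).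
  deviation-at : ∀ u v → ∑ (allFin k) (deviation (λ i → g i u v)) ≤
    ∑ (allFin k) mismatch +
    (n ^ suc ρ * (∑[ i ∈ allFin k ] (∑[ a ∈ V ] (∑[ b ∈ V ] turn i a b u))) +
     n ^ (2 + ρ) * (∑[ i ∈ allFin k ] (∑[ b ∈ V ] turn i b u v)))
  deviation-at u v = begin
    ∑ (allFin k) (deviation (λ i → g i u v))
      ≡⟨ ∑-cong (allFin k) (λ i → ∑-tuples₂ n (suc ρ) _) ⟩
    ∑[ i ∈ allFin k ] (∑[ a ∈ V ] (∑[ b ∈ V ] (∑[ y ∈ Y ] ι (h i (a ∷ b ∷ y) xor g i u v))))
      ≤⟨ ∑-mono (allFin k) per-colour ⟩
    ∑[ i ∈ allFin k ] (mismatch i + (n ^ suc ρ * (∑[ a ∈ V ] (∑[ b ∈ V ] turn i a b u)) + n ^ (2 + ρ) *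
      (∑[ b ∈ V ] turn i b u v)))
      ≡⟨ trans (∑-+ (allFin k) _ _) (cong (∑ (allFin k) mismatch +_) (trans (∑-+ (allFin k) _ _)
        (cong₂ _+_ (∑-* (allFin k) (n ^ suc ρ) _) (∑-* (allFin k) (n ^ (2 + ρ)) _)))) ⟩
    ∑ (allFin k) mismatch +
    (n ^ suc ρ * (∑[ i ∈ allFin k ] (∑[ a ∈ V ] (∑[ b ∈ V ] turn i a b u))) +
     n ^ (2 + ρ) * (∑[ i ∈ allFin k ] (∑[ b ∈ V ] turn i b u v))) ∎
    where
    open ≤-Reasoning
    Y = tuples n (suc ρ)
    pair : ∀ i a b → ∑[ y ∈ Y ] ι (h i (a ∷ b ∷ y) xor g i u v) ≤
           (∑[ y ∈ Y ] ι (h i (a ∷ b ∷ y) xor g i a b)) + (n ^ suc ρ * turn i a b u + n ^ suc ρ * turn i b u v)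
    pair i a b = begin
      ∑[ y ∈ Y ] ι (h i (a ∷ b ∷ y) xor g i u v)
        ≤⟨ ∑-mono Y (λ y → ≤-trans (xor-triangle (h i (a ∷ b ∷ y)) (g i a b) (g i u v))
          (+-monoʳ-≤ _ (xor-triangle (g i a b) (g i b u) (g i u v)))) ⟩
      ∑[ y ∈ Y ] (ι (h i (a ∷ b ∷ y) xor g i a b) + (turn i a b u + turn i b u v))
        ≡⟨ trans (∑-+ Y _ _) (cong (∑ Y (λ y → ι (h i (a ∷ b ∷ y) xor g i a b)) +_)
          (trans (∑-const-tuples n (suc ρ) _) (*-distribˡ-+ (n ^ suc ρ) _ _))) ⟩
      (∑[ y ∈ Y ] ι (h i (a ∷ b ∷ y) xor g i a b)) + (n ^ suc ρ * turn i a b u + n ^ suc ρ * turn i b u v) ∎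
    per-colour : ∀ i → ∑[ a ∈ V ] (∑[ b ∈ V ] (∑[ y ∈ Y ] ι (h i (a ∷ b ∷ y) xor g i u v))) ≤
                 mismatch i + (n ^ suc ρ * (∑[ a ∈ V ] (∑[ b ∈ V ] turn i a b u)) + n ^ (2 + ρ) * (∑[ b ∈ V ] turn i b u v))
    per-colour i = begin
      ∑[ a ∈ V ] (∑[ b ∈ V ] (∑[ y ∈ Y ] ι (h i (a ∷ b ∷ y) xor g i u v)))
        ≤⟨ ∑-mono V (λ a → ∑-mono V (λ b → pair i a b)) ⟩
      ∑[ a ∈ V ] (∑[ b ∈ V ] ((∑[ y ∈ Y ] ι (h i (a ∷ b ∷ y) xor g i a b)) +
        (n ^ suc ρ * turn i a b u + n ^ suc ρ * turn i b u v)))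
        ≡⟨ ∑-cong V (λ a → trans (∑-+ V _ _) (cong (∑ V (λ b → ∑ Y (λ y → ι (h i (a ∷ b ∷ y) xor g i a b))) +_)
          (trans (∑-+ V _ _) (cong₂ _+_ (∑-* V (n ^ suc ρ) _) (∑-* V (n ^ suc ρ) _))))) ⟩
      ∑[ a ∈ V ] ((∑[ b ∈ V ] (∑[ y ∈ Y ] ι (h i (a ∷ b ∷ y) xor g i a b))) +
        (n ^ suc ρ * (∑[ b ∈ V ] turn i a b u) + n ^ suc ρ * (∑[ b ∈ V ] turn i b u v)))
        ≡⟨ trans (∑-+ V _ _) (cong (mismatch i +_) (trans (∑-+ V _ _) (cong₂ _+_ (∑-* V (n ^ suc ρ) _)
          (trans (∑-const-allFin n _) (sym (*-assoc n (n ^ suc ρ) _)))))) ⟩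
      mismatch i + (n ^ suc ρ * (∑[ a ∈ V ] (∑[ b ∈ V ] turn i a b u)) + n ^ (2 + ρ) * (∑[ b ∈ V ] turn i b u v)) ∎

  -- The constant is `5 = 1 + 2 + 2`: on average over `u` and `v`, the mismatch costs at most `E`
  -- and each of the two turns at most `2 * E`, in units of `Q`.
  ∑-deviation : ∑[ u ∈ V ] (∑[ v ∈ V ] ∑ (allFin k) (deviation (λ i → g i u v))) ≤ n * (n * (5 * E * Q))
  ∑-deviation = begin
    ∑[ u ∈ V ] (∑[ v ∈ V ] ∑ (allFin k) (deviation (λ i → g i u v)))
      ≤⟨ ∑-mono V (λ u → ∑-mono V (λ v → deviation-at u v)) ⟩
    ∑[ u ∈ V ] (∑[ v ∈ V ] (Mis + (n ^ suc ρ * Y u + n ^ (2 + ρ) * Z u v)))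
      ≡⟨ ∑-cong V (λ u → trans (∑-+ V _ _) (cong (∑ V (λ _ → Mis) +_) (trans (∑-+ V _ _)
        (cong₂ _+_ (∑-const-allFin n _) (∑-* V (n ^ (2 + ρ)) _))))) ⟩
    ∑[ u ∈ V ] ((∑[ _ ∈ V ] Mis) + (n * (n ^ suc ρ * Y u) + n ^ (2 + ρ) * (∑[ v ∈ V ] Z u v)))
      ≡⟨ trans (∑-+ V _ _) (cong₂ _+_ (∑-∑-const n Mis) (trans (∑-+ V _ _)
        (cong₂ _+_ (trans (∑-* V n _) (cong (n *_) (∑-* V (n ^ suc ρ) _))) (∑-* V (n ^ (2 + ρ)) _)))) ⟩
    n * (n * Mis) + (n * (n ^ suc ρ * (∑[ u ∈ V ] Y u)) + n ^ (2 + ρ) * (∑[ u ∈ V ] (∑[ v ∈ V ] Z u v)))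
      ≡⟨ cong₂ (λ y z → n * (n * Mis) + (n * (n ^ suc ρ * y) + n ^ (2 + ρ) * z)) ∑Y ∑Z ⟩
    n * (n * Mis) + (n * (n ^ suc ρ * turns) + n ^ (2 + ρ) * turns)
      ≤⟨ +-mono-≤ (*-monoʳ-≤ n (*-monoʳ-≤ n mismatch-bound)) (+-mono-≤ (*-monoʳ-≤ n (*-monoʳ-≤ (n ^ suc ρ) turns-bound))
        (*-monoʳ-≤ (n ^ (2 + ρ)) turns-bound)) ⟩
    n * (n * (E * Q)) + (n * (n ^ suc ρ * (2 * E * (n * n))) + n ^ (2 + ρ) * (2 * E * (n * n)))
      ≡⟨ arith n E (n ^ ρ) ⟩
    n * (n * (5 * E * Q)) ∎
    where
    open ≤-Reasoning
    Mis = ∑ (allFin k) mismatch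
    Y : Fin n → ℕ
    Y u = ∑[ i ∈ allFin k ] (∑[ a ∈ V ] (∑[ b ∈ V ] turn i a b u))
    Z : Fin n → Fin n → ℕ
    Z u v = ∑[ i ∈ allFin k ] (∑[ b ∈ V ] turn i b u v)
    ∑Y : ∑ V Y ≡ turns
    ∑Y = trans (∑-comm V (allFin k) _) (∑-cong (allFin k) (λ i → ∑-rotate V V V (λ u a b → turn i a b u)))
    ∑Z : ∑[ u ∈ V ] (∑[ v ∈ V ] Z u v) ≡ turns
    ∑Z = trans (∑-cong V (λ u → ∑-rotate V (allFin k) V (λ v i b → turn i b u v)))
               (∑-rotate V (allFin k) V (λ u i b → ∑[ v ∈ V ] turn i b u v))
    arith : ∀ n E T → n * (n * (E * (n * (n * T)))) + (n * (n * T * (2 * E * (n * n))) + n * (n * T) * (2 * E * (n * n))) ≡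
                      n * (n * (5 * E * (n * (n * T))))
    arith = solve-∀

  -- Averaging over `u` and then over `v` fixes one pair whose richness in each colour predicts
  -- almost the whole colour.
  pattern-exists : Σ (Fin k → Bool) λ P → ∑ (allFin k) (deviation P) ≤ 5 * E * Q
  pattern-exists =
    let u , u≤ = average n {n * (5 * E * Q)} (λ u → ∑[ v ∈ V ] ∑ (allFin k) (deviation (λ i → g i u v))) 0<n ∑-deviation
        v , v≤ = average n {5 * E * Q} (λ v → ∑ (allFin k) (deviation (λ i → g i u v))) 0<n u≤
    in (λ i → g i u v) , v≤

  -- Reading off the almost complete colours

  module _ (P : Fin k → Bool) (dev≤ : ∑ (allFin k) (deviation P) ≤ 5 * E * Q) (large : 10 * E < n) where

    private
      ∣P∣ Dev : ℕ
      ∣P∣ = ∑[ i ∈ allFin k ] ι (P i)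
      Dev = ∑ (allFin k) (deviation P)

    ∑-constant : ∀ z → ∑[ _ ∈ tuples n r ] z ≡ n * Q * z
    ∑-constant z = ∑-const-tuples n r z

    P≤edges : ∀ i → n * Q * ι (P i) ≤ edges i + deviation P i
    P≤edges i = begin
      n * Q * ι (P i)                                        ≡⟨ ∑-constant (ι (P i)) ⟨
      ∑[ _ ∈ tuples n r ] ι (P i)                            ≤⟨ ∑-mono (tuples n r) (λ x → ≤-xor (h i x) (P i)) ⟩
      ∑[ x ∈ tuples n r ] (ι (h i x) + ι (h i x xor P i))    ≡⟨ ∑-+ (tuples n r) _ _ ⟩
      edges i + deviation P i                                ∎
      where open ≤-Reasoning

    edges≤P : ∀ i → edges i ≤ n * Q * ι (P i) + deviation P i
    edges≤P i = begin
      edges i                                                ≤⟨ ∑-mono (tuples n r)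
        (λ x → ≤-trans (≤-xor (P i) (h i x)) (≤-reflexive (cong (λ b → ι (P i) + ι b) (xor-comm (P i) (h i x))))) ⟩
      ∑[ x ∈ tuples n r ] (ι (P i) + ι (h i x xor P i))      ≡⟨ ∑-+ (tuples n r) _ _ ⟩
      (∑[ _ ∈ tuples n r ] ι (P i)) + deviation P i          ≡⟨ cong (_+ deviation P i) (∑-constant (ι (P i))) ⟩
      n * Q * ι (P i) + deviation P i                        ∎
      where open ≤-Reasoning

    -- One almost complete colour accounts for nearly `n * Q` tuples, while the errors collected
    -- below stay within `10 * E * Q`.
    n≰10E : ¬ n * Q ≤ 10 * E * Q
    n≰10E le = <⇒≱ large (*-cancelʳ-≤ n (10 * E) Q le)

    -- `∣P∣ * (n * Q)` and the number of ordered edges differ by at most `5 * E * Q`, while the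
    -- latter is `m * (n * Q)` up to `K * Q` above and `L * Q` below. An error of one in `∣P∣` would
    -- cost a whole `n * Q`.
    prefix-size : ∣P∣ ≡ m
    prefix-size = ≤-antisym (≮⇒≥ too-big) (≮⇒≥ too-small)
      where
      open ≤-Reasoning
      arith : ∀ s n Q → suc s * (n * Q) ≡ n * Q + s * (n * Q)
      arith = solve-∀
      arith₂ : ∀ s n Q K E → s * (n * Q) + K * Q + 5 * E * Q ≡ (K + 5 * E) * Q + s * (n * Q)
      arith₂ = solve-∀
      small : ∀ {K} → K ≤ E → (K + 5 * E) * Q ≤ 10 * E * Q
      small {K} K≤E = *-monoˡ-≤ Q (≤-trans (+-monoˡ-≤ (5 * E) K≤E) (≤-trans (m≤m+n (E + 5 * E) (4 * E))
        (≤-reflexive (arith₃ E))))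
        where
        arith₃ : ∀ E → E + 5 * E + 4 * E ≡ 10 * E
        arith₃ = solve-∀
      ∑-P≤ : ∣P∣ * (n * Q) ≤ F * totalEdges H + Dev
      ∑-P≤ = begin
        ∣P∣ * (n * Q)                                  ≡⟨ trans (*-comm ∣P∣ (n * Q)) (sym (∑-* (allFin k) (n * Q) _)) ⟩
        ∑[ i ∈ allFin k ] n * Q * ι (P i)              ≤⟨ ∑-mono (allFin k) P≤edges ⟩
        ∑[ i ∈ allFin k ] (edges i + deviation P i)    ≡⟨ trans (∑-+ (allFin k) _ _) (cong (_+ Dev) ∑-edges) ⟩
        F * totalEdges H + Dev                       ∎
      ∑-edges≤ : F * totalEdges H ≤ ∣P∣ * (n * Q) + Dev
      ∑-edges≤ = begin
        F * totalEdges H                                     ≡⟨ ∑-edges ⟨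
        ∑ (allFin k) edges                                     ≤⟨ ∑-mono (allFin k) edges≤P ⟩
        ∑[ i ∈ allFin k ] (n * Q * ι (P i) + deviation P i)    ≡⟨ ∑-+ (allFin k) _ _ ⟩
        (∑[ i ∈ allFin k ] n * Q * ι (P i)) + Dev              ≡⟨ cong (_+ Dev)
          (trans (∑-* (allFin k) (n * Q) _) (*-comm (n * Q) ∣P∣)) ⟩
        ∣P∣ * (n * Q) + Dev                                    ∎
      too-big : ¬ m < ∣P∣
      too-big m<P = n≰10E (≤-trans (+-cancelʳ-≤ (m * (n * Q)) _ _ (begin
        n * Q + m * (n * Q)                                     ≡⟨ arith m n Q ⟨
        suc m * (n * Q)                                         ≤⟨ *-monoˡ-≤ (n * Q) m<P ⟩
        ∣P∣ * (n * Q)                                           ≤⟨ ∑-P≤ ⟩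
        F * totalEdges H + Dev                                ≤⟨ +-mono-≤ (≤-trans (m≤n+m _ _) mismatch+edges) dev≤ ⟩
        m * (n * Q) + K * Q + 5 * E * Q     ≡⟨ arith₂ m n Q K E ⟩
        (K + 5 * E) * Q + m * (n * Q)         ∎)) (small (m≤m+n K L)))
      too-small : ¬ ∣P∣ < m
      too-small P<m = n≰10E (≤-trans (+-cancelʳ-≤ (∣P∣ * (n * Q)) _ _ (begin
        n * Q + ∣P∣ * (n * Q)                                   ≡⟨ arith ∣P∣ n Q ⟨
        suc ∣P∣ * (n * Q)                                       ≤⟨ *-monoˡ-≤ (n * Q) P<m ⟩
        m * (n * Q)                                             ≤⟨ edges-lower ⟩
        F * totalEdges H + L * Q                              ≤⟨ +-monoˡ-≤ (L * Q) (≤-trans ∑-edges≤ (+-monoʳ-≤ _ dev≤)) ⟩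
        ∣P∣ * (n * Q) + 5 * E * Q + L * Q                       ≡⟨ arith₄ (∣P∣ * (n * Q)) E L Q ⟩
        (L + 5 * E) * Q + ∣P∣ * (n * Q)                         ∎)) (small (m≤n+m L K)))
        where
        arith₄ : ∀ s E L Q → s + 5 * E * Q + L * Q ≡ (L + 5 * E) * Q + s
        arith₄ = solve-∀

    -- If `P` held at `j` but failed at `i`, colour `j` would have nearly `n * Q` ordered edges and
    -- colour `i` few, against the ordering by size. The two deviations give `5 + 5 = 10`.
    prefix-down : (∀ i j → i ≤ᶠ j → e (H j) ≤ e (H i)) → ∀ {i j} → i ≤ᶠ j → P j ≡ true → P i ≡ true
    prefix-down mono {i} {j} i≤j Pj with P i in Pi
    ... | true  = refl
    ... | false = ⊥-elim (n≰10E (begin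
      n * Q                                              ≡⟨ *-identityʳ (n * Q) ⟨
      n * Q * 1                                          ≡⟨ cong (λ b → n * Q * ι b) Pj ⟨
      n * Q * ι (P j)                                    ≤⟨ P≤edges j ⟩
      edges j + deviation P j                            ≤⟨ +-monoˡ-≤ _ edges-mono ⟩
      edges i + deviation P j                            ≤⟨ +-monoˡ-≤ _ (edges≤P i) ⟩
      n * Q * ι (P i) + deviation P i + deviation P j    ≡⟨ cong (λ z → z + deviation P i + deviation P j)
        (trans (cong (λ b → n * Q * ι b) Pi) (*-zeroʳ (n * Q))) ⟩
      deviation P i + deviation P j                      ≤⟨ +-mono-≤ (≤-trans (∑-∈ (∈-allFin i)) dev≤)
        (≤-trans (∑-∈ (∈-allFin j)) dev≤) ⟩
      5 * E * Q + 5 * E * Q                              ≡⟨ arith E Q ⟩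
      10 * E * Q                                         ∎))
      where
      open ≤-Reasoning
      arith : ∀ E Q → 5 * E * Q + 5 * E * Q ≡ 10 * E * Q
      arith = solve-∀
      edges-mono : edges j ≤ edges i
      edges-mono = begin
        edges j         ≡⟨ edges≡ j ⟩
        F * e (H j)   ≤⟨ *-monoʳ-≤ (F) (mono i j i≤j) ⟩
        F * e (H i)   ≡⟨ edges≡ i ⟨
        edges i         ∎

    exceptional : Hypergraph n
    exceptional s = anyB (λ i → H i s xor P i)

    deleted-bound : deleted H exceptional ≤ 5 * E * Q
    deleted-bound = begin
      deleted H exceptional
        ≡⟨ length-filterᵇ (λ s → unionH H s ∧B exceptional s) (allSubsets n) ⟩
      ∑[ s ∈ allSubsets n ] ι (unionH H s ∧B exceptional s)
        ≤⟨ ∑-mono (allSubsets n) edge-sized ⟩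
      ∑[ s ∈ allSubsets n ] ι (sized r s) * (∑[ i ∈ allFin k ] ι (H i s xor P i))
        -- Each `r`-set stands for `F` tuples, so this bound gives away a constant factor.
        ≤⟨ m≤n*m _ F {{subst NonZero (sym F≡) (r !≢0)}} ⟩
      F * (∑[ s ∈ allSubsets n ] ι (sized r s) * (∑[ i ∈ allFin k ] ι (H i s xor P i)))
        ≡⟨ trans (∑-distinct r (λ s → ∑[ i ∈ allFin k ] ι (H i s xor P i)))
          (cong (_* (∑[ s ∈ allSubsets n ] ι (sized r s) * (∑[ i ∈ allFin k ] ι (H i s xor P i)))) (sym F≡)) ⟨
      ∑[ x ∈ tuples n r ] ι (distinct x) * (∑[ i ∈ allFin k ] ι (H i (verts x) xor P i))
        ≤⟨ ∑-mono (tuples n r) on-distinct ⟩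
      ∑[ x ∈ tuples n r ] (∑[ i ∈ allFin k ] ι (h i x xor P i))
        ≡⟨ ∑-comm (tuples n r) (allFin k) _ ⟩
      Dev
        ≤⟨ dev≤ ⟩
      5 * E * Q ∎
      where
      open ≤-Reasoning
      edge-sized : ∀ s → ι (unionH H s ∧B exceptional s) ≤ ι (sized r s) * (∑[ i ∈ allFin k ] ι (H i s xor P i))
      edge-sized s with unionH H s in eq
      ... | false = z≤n
      ... | true with i , Hi ← anyB-∃ (λ i → H i s) eq rewrite uniform i s Hi | dec-true (r ≟ r) refl =
        ≤-trans (anyB-∑ (λ i → H i s xor P i)) (m≤m+n _ 0)
      on-distinct : ∀ x → ι (distinct x) * (∑[ i ∈ allFin k ] ι (H i (verts x) xor P i)) ≤ ∑[ i ∈ allFin k ] ι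
        (h i x xor P i)
      on-distinct x with distinct x
      ... | false = z≤n
      ... | true  = ≤-reflexive (+-identityʳ _)

    agreement : (∀ i j → i ≤ᶠ j → e (H j) ≤ e (H i)) →
                ∀ s → exceptional s ≡ false → ∀ i → (H i s ≡ true) ⇔ (toℕ i < m)
    agreement mono s s-ok i =
      mk⇔ (λ Hi → <ᵇ-true (trans (sym Hi≡) Hi)) (λ i<m → trans Hi≡ (Equivalence.to T-≡ (<⇒<ᵇ i<m)))
      where
      Hi≡ : H i s ≡ (toℕ i <ᵇ m)
      Hi≡ = trans (xor-false (anyB-∀ (λ i → H i s xor P i) s-ok i)) (downset-prefix m P (prefix-down mono) prefix-size i)

  stability : 10 * E < n → (∀ i j → i ≤ᶠ j → e (H j) ≤ e (H i)) →
    Σ (Hypergraph n) λ D → deleted H D ≤ 5 * E * Q ×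
      (∀ s → D s ≡ false → ∀ i → (H i s ≡ true) ⇔ (toℕ i < m))
  stability large mono =
    let P , dev≤ = pattern-exists
    in exceptional P dev≤ large , deleted-bound P dev≤ large , agreement P dev≤ large mono

-- Parameters and conclusion

1+m≡ℓC2 : ∀ {ℓ} → 3 ≤ ℓ → suc ((ℓ C 2) ∸ 1) ≡ ℓ C 2 × 0 < (ℓ C 2) ∸ 1
1+m≡ℓC2 {suc (suc (suc ℓ))} (s≤s (s≤s (s≤s z≤n))) rewrite [1+n]C2 (2 + ℓ) = refl , z<s

-- The upper bound on `k = m + q` enters here: since `ℓ² = 2 (m + 1) + ℓ`, it says exactly that the
-- surplus `q` is at most half of `ℓ`.
2q≤ℓ : ∀ {ℓ m q} → suc m ≡ ℓ C 2 → 2 * (m + q) + 1 < ℓ * ℓ → 2 * q ≤ ℓ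
2q≤ℓ {ℓ} {m} {q} M≡ lt = +-cancelˡ-≤ (2 * suc m) _ _ (begin
  2 * suc m + 2 * q      ≡⟨ arith m q ⟩
  suc (2 * (m + q) + 1)  ≤⟨ lt ⟩
  ℓ * ℓ                  ≡⟨ 2*nC2+n ℓ ⟨
  2 * (ℓ C 2) + ℓ        ≡⟨ cong (λ z → 2 * z + ℓ) M≡ ⟨
  2 * suc m + ℓ          ∎)
  where
  open ≤-Reasoning
  arith : ∀ m q → 2 * suc m + 2 * q ≡ suc (2 * (m + q) + 1)
  arith = solve-∀

module _ (ρ ℓ m q : ℕ) (3≤ℓ : 3 ≤ ℓ) (M≡ : suc m ≡ ℓ C 2) (2q≤ : 2 * q ≤ ℓ)
         {n k : ℕ} (k≡ : m + q ≡ k) (i₀ : Fin k) (H : Fin k → Hypergraph n)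
         (rainbow-free : ¬ RainbowExpansion ℓ (3 + ρ) H) where

  private
    f t : ℕ
    -- `f` is the number of vertices of the expansion, as `suc ρ = r - 2`; `t` is the richness
    -- threshold that `rich-avoid` asks for.
    f = ℓ + (ℓ C 2) * suc ρ
    t = suc ρ * f

  multiplicity≤ : ∀ a b → multiplicity ρ t H a b ≤ k
  multiplicity≤ a b = ≤-trans (∑-mono (allFin k) (λ i → ι≤1 (rich ρ t H i a b)))
    (≤-reflexive (trans (∑-const-allFin k 1) (*-identityʳ k)))

  multiplicity-sym : ∀ a b → multiplicity ρ t H a b ≡ multiplicity ρ t H b a
  multiplicity-sym a b = ∑-cong (allFin k) (λ i → cong (λ z → ι (t * n ^ ρ <ᵇ z)) (codegree-sym (suc ρ) (H i) a b))

  dense⇒rainbow : ∀ xs → Dense (multiplicity ρ t H) m xs → length xs ≡ ℓ → RainbowExpansion (length xs) (3 + ρ) H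
  dense⇒rainbow xs D refl =
    rainbow ρ t H f ≤-refl i₀ xs (≤-trans z<s 3≤ℓ) ≤-refl
      (few-lightPairs (multiplicity ρ t H) xs D (λ a b → ≤-trans (multiplicity≤ a b) (≤-reflexive (sym k≡))) M≡ 2q≤)

  multiplicity-bound : weight (multiplicity ρ t H) (allFin n) (allFin n) ≤ m * (n * n) + k * ℓ * n
  multiplicity-bound = subst (λ N → weight (multiplicity ρ t H) (allFin n) (allFin n) ≤ m * (N * N) + k * ℓ * N)
    (length-allFin n)
    (weight-bound (multiplicity ρ t H) m ℓ
      (λ {xs} D len → rainbow-free (subst (λ l → RainbowExpansion l (3 + ρ) H) len (dense⇒rainbow xs D len)))
      k (≤-trans z<s 3≤ℓ) multiplicity-sym multiplicity≤ (allFin n))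

theorem3p4 : (ℓ r k : ℕ) → 3 ≤ r → r ≤ ℓ →
    (ℓ C 2) ∸ 1 ≤ k → 2 * k + 1 < ℓ * ℓ →
    (c : ℕ) → 0 < c →
    Σ ℕ λ C′ → 0 < C′ × Σ ℕ λ n₀ →
    (n : ℕ) → n₀ ≤ n →
    (H : Fin k → Hypergraph n) →
    (∀ i → Uniform r (H i)) →
    ¬ RainbowExpansion ℓ r H →
    (∀ i j → i ≤ᶠ j → e (H j) ≤ e (H i)) →
    ((ℓ C 2) ∸ 1) * (n C r) ≤ totalEdges H + c * n ^ (r ∸ 1) →
    Σ (Hypergraph n) λ D →
    deleted H D ≤ C′ * n ^ (r ∸ 1) ×
    (∀ s → InUnion H s → D s ≡ false →
    ∀ i → (H i s ≡ true) ⇔ (toℕ i < (ℓ C 2) ∸ 1))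
theorem3p4 ℓ (suc (suc (suc ρ))) k 3≤r@(s≤s (s≤s (s≤s _))) r≤ℓ m≤k k< c _ =
  -- The first `suc` makes the constant positive; the second turns `n₀≤n` into `10 * E < n`, which
  -- also gives `0 < n`.
  suc (5 * E) , z<s , suc (10 * E) , λ n n₀≤n H uniform rainbow-free mono total≥ →
    let D , D≤ , agree = stability ρ b m ℓ c H (≤-<-trans z≤n n₀≤n) ((3 + ρ) !) refl uniform
                           -- The default colour exists because `0 < m ≤ k`.
                           (multiplicity-bound ρ ℓ m q 3≤ℓ M≡ 2q≤ k≡ (fromℕ< (<-≤-trans 0<m m≤k)) H rainbow-free)
                           total≥ n₀≤n mono
    in D , ≤-trans D≤ (m≤n+m _ (n ^ (2 + ρ))) , λ s _ → agree s
  where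
  m q b E : ℕ
  m = (ℓ C 2) ∸ 1
  q = k ∸ m
  b = suc ρ * (ℓ + (ℓ C 2) * suc ρ)
  E = k * ℓ + k * (2 * b) + ((3 + ρ) ! * c + m * ((3 + ρ) * (3 + ρ)))
  3≤ℓ : 3 ≤ ℓ
  3≤ℓ = ≤-trans 3≤r r≤ℓ
  M≡ : suc m ≡ ℓ C 2
  M≡ = proj₁ (1+m≡ℓC2 3≤ℓ)
  0<m : 0 < m
  0<m = proj₂ (1+m≡ℓC2 3≤ℓ)
  k≡ : m + q ≡ k
  k≡ = m+[n∸m]≡n m≤k
  2q≤ : 2 * q ≤ ℓ
  2q≤ = 2q≤ℓ {ℓ} {m} {q} M≡ (subst (λ z → 2 * z + 1 < ℓ * ℓ) (sym k≡) k<)
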